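{- Let $G=(V,E)$ be a simple graph with $n$ vertices, $m$ edges, maximum degree $\Delta$ and arboricity $\alpha$, and let $\frac{1}{\alpha}\leq\varepsilon<1$. Procedure Arboricity Edge-Coloring with parameter $h=\max\{\lfloor\log(\varepsilon\alpha/3)\rfloor,0\}$ computes a proper edge-coloring of $G$ using at most $\Delta+\varepsilon\alpha$ colors in $O\left(\frac{m\log n}{\varepsilon^{7}}\right)$ deterministic time. Its randomized version requires $O\left(\frac{m\log n}{\varepsilon}\right)$ expected time.
   Context: Logarithms are base 2. The arboricity of $G$ is $\alpha(G)=\max_{S\subseteq V,|S|\ge2}\lceil |E(G[S])|/(|S|-1)\rceil$. A proper $k$-edge-coloring is a map $\varphi:E\to\{1,\dots,k\}$ assigning distinct colors to distinct edges sharing an endpoint. An orientation $\mu$ assigns a direction to each edge; $\mathrm{indeg}(v)$, $\mathrm{outdeg}(v)$ are the in/out-degrees. An oriented degree-splitting of $(G,\mu)$ with discrepancy $\kappa$ is a partition $(E_1,E_2)$ of $E$ such that for every vertex $v$, the numbers of incoming edges of $v$ in $E_1$ and in $E_2$ differ by at most $\kappa$, and the numbers of outgoing edges of $v$ in $E_1$ and in $E_2$ differ by at most $\kappa$. Procedure Forests-Decomposition Orientation$(G)$: starting from $\mathcal A=V$, repeatedly pick $v\in\mathcal A$ of minimum degree in $G[\mathcal A]$, orient every edge from $v$ to its neighbours in $\mathcal A$, and remove $v$ from $\mathcal A$, until $\mathcal A=\emptyset$. Procedure Oriented Edge-Coloring$(G,\mu,h)$: if $h=0$, return a proper $(\Delta(G)+1)$-edge-coloring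 of (the undirected) $G$ computed by a base-case subroutine. Otherwise compute an oriented degree-splitting $(E_1,E_2)$ of $(G,\mu)$ with discrepancy at most 1 (computable in $O(|E|)$ time), let $G_1=(V,E_1)$, $G_2=(V,E_2)$ with the orientation induced by $\mu$, recursively compute $\varphi_1=$ Oriented Edge-Coloring$(G_1,\mu,h-1)$, $\varphi_2=$ Oriented Edge-Coloring$(G_2,\mu,h-1)$, and return $\varphi(e)=\varphi_1(e)$ on $E_1$ and $\varphi(e)=p_1+\varphi_2(e)$ on $E_2$, where $p_1$ is the palette size of $\varphi_1$. Procedure Arboricity Edge-Coloring$(G,h)$: compute $\mu=$ Forests-Decomposition Orientation$(G)$ and return Oriented Edge-Coloring$(G,\mu,h)$. Deterministic version: the base-case subroutine is a deterministic algorithm computing a proper $(\Delta'+1)$-edge-coloring of an $n'$-vertex $m'$-edge graph with maximum degree $\Delta'$ and arboricity $\alpha'$ in $O(m'\alpha'^7\log n')$ time. Randomized version: the base-case subroutine is a randomized algorithm computing a proper $(\Delta'+1)$-edge-coloring in expected $O(m'\alpha'\log n')$ time. -}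

module Defs where

open import Level using (0ℓ)
open import Algebra.Bundles using (Semiring; CommutativeRing)
open import Algebra.Core using (Op₁; Op₂)
import Algebra.Definitions.RawSemiring as RawSemiringDefs
import Algebra.Definitions.RawMonoid as RawMonoidDefs
open import Algebra.Structures using (IsCommutativeRing)
open import Data.Bool.Base using (Bool; true; false; if_then_else_; _∧_)
open import Data.Fin.Base as Fin using (Fin; toℕ)
open import Data.Fin.Properties using (_≟_)
open import Data.Fin.Subset
  using (Subset; inside; outside; ∣_∣; Nonempty)
  renaming (_∈_ to _∈ₛ_; _-_ to _∖_)
open import Data.Fin.Subset.Properties
  using (nonempty?) renaming (_∈?_ to _∈ₛ?_)
open import Data.Integer.Base using (ℤ; +_; -[1+_]; 0ℤ)
import Data.Integer.Base as ℤ
open import Data.List.Base using (List; []; _∷_; _++_; map; filter; length; allFin)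
open import Data.List.Extrema.Nat using (max)
open import Data.List.Membership.Propositional using (_∈_)
import Data.List.Membership.DecPropositional as DecMembership
open import Data.List.Relation.Binary.Permutation.Propositional using (_↭_)
open import Data.List.Relation.Unary.All using (All)
open import Data.List.Relation.Unary.Unique.Propositional using (Unique)
open import Data.Nat.Base as ℕ using (ℕ; zero; suc; ∣_-_∣)
open import Data.Nat.DivMod using (_/_)
open import Data.Nat.Logarithm using (⌈log₂_⌉)
import Data.Nat.Properties as ℕ
open import Data.Product.Base using (Σ; ∃; _×_; _,_; proj₁; proj₂; uncurry)
open import Data.Product.Properties using (≡-dec)
open import Data.Sum.Base using (_⊎_)
import Data.Vec.Base as Vec
open import Data.Unit.Base using (⊤; tt)
open import Relation.Binary.Core using (Rel)
open import Relation.Binary.Definitions using (DecidableEquality)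
open import Relation.Binary.PropositionalEquality.Core using (_≡_; _≢_)
open import Relation.Binary.Structures using (IsTotalOrder)
import Relation.Binary.Construct.NonStrictToStrict as ToStrict
open import Relation.Nullary.Decidable using (Dec; yes; no; does; _×-dec_; _⊎-dec_)
open import Relation.Nullary.Negation using (¬_)

------------------------------------------------------------------------
-- Real parameters and probabilities range over an arbitrary ordered
-- field; the real numbers are the intended instance, and nothing beyond
-- the ordered-field axioms is used.

record OrderedField : Set₁ where
  infix  8 _⁻¹
  infixl 7 _*_
  infixl 6 _+_
  infix  4 _≈_ _≤_
  field
    Carrier           : Set
    _≈_               : Rel Carrier 0ℓ
    _≤_               : Rel Carrier 0ℓ
    _+_ _*_           : Op₂ Carrier
    -_                : Op₁ Carrier
    0# 1#             : Carrier
    -- Only constrained away from 0.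
    _⁻¹               : Op₁ Carrier
    isCommutativeRing : IsCommutativeRing _≈_ _+_ _*_ -_ 0# 1#
    isTotalOrder      : IsTotalOrder _≈_ _≤_
    1≉0               : ¬ (1# ≈ 0#)
    *-inverseʳ        : ∀ x → ¬ (x ≈ 0#) → x * x ⁻¹ ≈ 1#
    +-monoˡ-≤         : ∀ z {x y} → x ≤ y → x + z ≤ y + z
    *-nonNeg          : ∀ {x y} → 0# ≤ x → 0# ≤ y → 0# ≤ x * y

  commutativeRing : CommutativeRing 0ℓ 0ℓ
  commutativeRing = record { isCommutativeRing = isCommutativeRing }

  private module R = CommutativeRing commutativeRing

  open RawSemiringDefs (Semiring.rawSemiring R.semiring) public
    using (_^_) renaming (_×_ to _·_)
  open RawMonoidDefs R.+-rawMonoid public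
    using (sum)

  open ToStrict _≈_ _≤_ public using (_<_)

  infixl 7 _÷_
  _÷_ : Op₂ Carrier
  x ÷ y = x * y ⁻¹

  fromℕ : ℕ → Carrier
  fromℕ n = n · 1#

  2^_ : ℤ → Carrier
  2^ (+ k)      = fromℕ 2 ^ k
  2^ (-[1+ k ]) = (fromℕ 2 ^ suc k) ⁻¹

  -- ⌊log₂ x⌋ = k, where k may be negative.
  ⌊log₂_⌋≡_ : Carrier → ℤ → Set
  ⌊log₂ x ⌋≡ k = (2^ k ≤ x) × (x < 2^ (ℤ.suc k))

------------------------------------------------------------------------
-- Graphs.  The vertex set is Fin n; an undirected edge {u,v} is stored
-- as the pair with u < v, so that edges are compared by equality.

Edge : ℕ → Set
Edge n = Fin n × Fin n

Graph : ℕ → Set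
Graph n = List (Edge n)

IsSimple : ∀ {n} → Graph n → Set
IsSimple G = All (uncurry Fin._<_) G × Unique G

_≟ₑ_ : ∀ {n} → DecidableEquality (Edge n)
_≟ₑ_ = ≡-dec _≟_ _≟_

_∈ₑ?_ : ∀ {n} (e : Edge n) (G : Graph n) → Dec (e ∈ G)
_∈ₑ?_ = DecMembership._∈?_ _≟ₑ_

Incident : ∀ {n} → Fin n → Edge n → Set
Incident v (a , b) = (v ≡ a) ⊎ (v ≡ b)

incident? : ∀ {n} (v : Fin n) (e : Edge n) → Dec (Incident v e)
incident? v (a , b) = (v ≟ a) ⊎-dec (v ≟ b)

degree : ∀ {n} → Graph n → Fin n → ℕ
degree G v = length (filter (incident? v) G)

maxDegree : ∀ {n} → Graph n → ℕ
maxDegree {n} G = max 0 (map (degree G) (allFin n))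

infix 9 _[_]

_[_] : ∀ {n} → Graph n → Subset n → Graph n
G [ S ] = filter (λ (a , b) → (a ∈ₛ? S) ×-dec (b ∈ₛ? S)) G

allSubsets : ∀ n → List (Subset n)
allSubsets zero    = Vec.[] ∷ []
allSubsets (suc n) =
  map (inside Vec.∷_) (allSubsets n) ++ map (outside Vec.∷_) (allSubsets n)

-- ⌈ e / (s - 1) ⌉ for s ≥ 2; the other values are irrelevant.
⌈_/pred_⌉ : ℕ → ℕ → ℕ
⌈ e /pred suc (suc k) ⌉ = (e ℕ.+ k) / suc k
⌈ e /pred _ ⌉           = 0

arboricity : ∀ {n} → Graph n → ℕ
arboricity {n} G =
  max 0 (map (λ S → ⌈ length (G [ S ]) /pred ∣ S ∣ ⌉)
             (filter (λ S → 2 ℕ.≤? ∣ S ∣) (allSubsets n)))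

------------------------------------------------------------------------
-- Edge-colorings.  Values of a coloring outside the edge set are
-- irrelevant.

ProperEdgeColoring : ∀ {n} → Graph n → ℕ → (Edge n → ℕ) → Set
ProperEdgeColoring G k φ =
  (∀ {e} → e ∈ G → (1 ℕ.≤ φ e) × (φ e ℕ.≤ k)) ×
  (∀ {e f} → e ∈ G → f ∈ G → e ≢ f →
     (∃ λ v → Incident v e × Incident v f) → φ e ≢ φ f)

------------------------------------------------------------------------
-- Orientations: true directs the edge (a , b) from a to b, false from
-- b to a.

Orientation : ℕ → Set
Orientation n = Edge n → Bool

tail head : ∀ {n} → Orientation n → Edge n → Fin n
tail μ e = if μ e then proj₁ e else proj₂ e
head μ e = if μ e then proj₂ e else proj₁ e

indeg outdeg : ∀ {n} → Graph n → Orientation n → Fin n → ℕ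
indeg  G μ v = length (filter (λ e → head μ e ≟ v) G)
outdeg G μ v = length (filter (λ e → tail μ e ≟ v) G)

IsOrientedDegreeSplitting :
  ∀ {n} → Graph n → Orientation n → ℕ → Graph n × Graph n → Set
IsOrientedDegreeSplitting G μ κ (E₁ , E₂) =
  (E₁ ++ E₂ ↭ G) ×
  (∀ v → (∣ indeg  E₁ μ v - indeg  E₂ μ v ∣ ℕ.≤ κ) ×
         (∣ outdeg E₁ μ v - outdeg E₂ μ v ∣ ℕ.≤ κ))

-- A rule for "pick v ∈ A of minimum degree in G[A]".  Quantifying over
-- all rules covers every way of breaking ties: a run meets each A at
-- most once, so memoryless rules produce all runs.

MinDegreeRule : Set
MinDegreeRule =
  ∀ {n} (G : Graph n) (A : Subset n) → Nonempty A →
  Σ (Fin n) λ v → (v ∈ₛ A) ×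
    (∀ {w} → w ∈ₛ A → degree (G [ A ]) v ℕ.≤ degree (G [ A ]) w)

nonIsolated : ∀ {n} → Graph n → Subset n
nonIsolated G = Vec.tabulate λ v → does (1 ℕ.≤? degree G v)

-- Orient every edge from v to its neighbours in A.
orientFrom : ∀ {n} → Fin n → Subset n → Orientation n → Orientation n
orientFrom v A μ e@(a , b) =
  if does (v ≟ a) ∧ does (b ∈ₛ? A) then true else
  if does (v ≟ b) ∧ does (a ∈ₛ? A) then false else
  μ e

------------------------------------------------------------------------

module Algorithms (F : OrderedField) where
  open OrderedField F

  ----------------------------------------------------------------------
  -- Computations with explicit unit-cost steps and random choices.

  Σ[i<_]_ : ℕ → (ℕ → Carrier) → Carrier
  Σ[i< N ] f = sum {N} (λ i → f (toℕ i))

  record Distribution : Set where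
    field
      weight    : ℕ → Carrier
      nonNeg    : ∀ i → 0# ≤ weight i
      total≤1   : ∀ N → (Σ[i< N ] weight) ≤ 1#
      total→1   : ∀ δ → 0# < δ → ∃ λ N → 1# ≤ (Σ[i< N ] weight) + δ

  open Distribution public

  -- Coin-flipping algorithms with unbounded running time that halt
  -- almost surely are included: draw a halting coin sequence, of which
  -- there are countably many.
  data Comp (A : Set) : Set where
    return : A → Comp A
    tick   : Comp A → Comp A
    draw   : Distribution → (ℕ → Comp A) → Comp A

  infixl 1 _>>=_ _>>_

  _>>=_ : ∀ {A B} → Comp A → (A → Comp B) → Comp B
  return a >>= f = f a
  tick c   >>= f = tick (c >>= f)
  draw d k >>= f = draw d (λ i → k i >>= f)

  _>>_ : ∀ {A B} → Comp A → Comp B → Comp B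
  c >> c′ = c >>= λ _ → c′

  ticks : ℕ → Comp ⊤
  ticks zero    = return tt
  ticks (suc t) = tick (ticks t)

  -- c ⇓ a # t : some execution of c of positive probability returns a
  -- after t steps.
  infix 3 _⇓_#_
  data _⇓_#_ {A : Set} : Comp A → A → ℕ → Set where
    return : ∀ {a} → return a ⇓ a # 0
    tick   : ∀ {c a t} → c ⇓ a # t → tick c ⇓ a # suc t
    draw   : ∀ {d k a t} i → 0# < weight d i → k i ⇓ a # t → draw d k ⇓ a # t

  data Deterministic {A : Set} : Comp A → Set where
    return : ∀ {a} → Deterministic (return a)
    tick   : ∀ {c} → Deterministic c → Deterministic (tick c)

  -- Expected number of steps when every draw is truncated to its first
  -- N values (the others contribute 0).  It increases with N, and its
  -- supremum is the expected number of steps by monotone convergence.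
  truncatedExpectedTime : ∀ {A} → ℕ → Comp A → Carrier
  truncatedExpectedTime N (return _) = 0#
  truncatedExpectedTime N (tick c)   = 1# + truncatedExpectedTime N c
  truncatedExpectedTime N (draw d k) =
    Σ[i< N ] (λ i → weight d i * truncatedExpectedTime N (k i))

  ExpectedTime_≤_ : ∀ {A} → Comp A → Carrier → Set
  ExpectedTime c ≤ q = ∀ N → truncatedExpectedTime N c ≤ q

  ----------------------------------------------------------------------
  -- Subroutines.  In the O(·) bounds the summand 1 admits subroutines
  -- that spend constant time on inputs for which the given expression
  -- vanishes, such as edgeless graphs.

  SplitSubroutine : Set
  SplitSubroutine = ∀ {n} → Graph n → Orientation n → Comp (Graph n × Graph n)

  IsLinearTimeSplitting : SplitSubroutine → Set
  IsLinearTimeSplitting split =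
    ∃ λ c → ∀ {n} (G : Graph n) (μ : Orientation n) → IsSimple G →
      Deterministic (split G μ) ×
      (∀ {E t} → split G μ ⇓ E # t →
         IsOrientedDegreeSplitting G μ 1 E ×
         t ℕ.≤ c ℕ.* (1 ℕ.+ length G))

  BaseSubroutine : Set
  BaseSubroutine = ∀ {n} → Graph n → Comp (Edge n → ℕ)

  IsDeterministicBase : BaseSubroutine → Set
  IsDeterministicBase base =
    ∃ λ c → ∀ {n} (G : Graph n) → IsSimple G →
      Deterministic (base G) ×
      (∀ {φ t} → base G ⇓ φ # t →
         ProperEdgeColoring G (maxDegree G ℕ.+ 1) φ ×
         t ℕ.≤ c ℕ.* (1 ℕ.+ length G ℕ.* arboricity G ℕ.^ 7 ℕ.* ⌈log₂ n ⌉))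

  IsRandomizedBase : BaseSubroutine → Set
  IsRandomizedBase base =
    ∃ λ c → ∀ {n} (G : Graph n) → IsSimple G →
      (∀ {φ t} → base G ⇓ φ # t →
         ProperEdgeColoring G (maxDegree G ℕ.+ 1) φ) ×
      (ExpectedTime base G ≤
         fromℕ (c ℕ.* (1 ℕ.+ length G ℕ.* arboricity G ℕ.* ⌈log₂ n ⌉)))

  ----------------------------------------------------------------------
  -- The procedures.

  -- Costs are those of a bucket queue keyed by the degree in G[A].
  -- Removing a vertex lowers the minimum degree by at most 1, so the
  -- search for the next vertex inspects the buckets from d - 1 on, where
  -- d is the previous minimum, up to the new minimum.  Scanning the
  -- edges at v, orienting them and moving neighbours to the next lower
  -- bucket takes constant time per edge.
  peel : ∀ {n} → MinDegreeRule → Graph n →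
         (rounds : ℕ) (A : Subset n) (d : ℕ) → Orientation n → Comp (Orientation n)
  peel rule G zero           A d μ = return μ
  peel rule G (suc rounds) A d μ with nonempty? A
  ... | no  _  = return μ
  ... | yes A≢∅ = do
    let v  = proj₁ (rule G A A≢∅)
        d′ = degree (G [ A ]) v
    ticks (suc d′ ℕ.∸ (d ℕ.∸ 1))
    ticks (degree G v)
    peel rule G rounds (A ∖ v) d′ (orientFrom v A μ)

  -- Isolated vertices would be picked first and orient nothing; reading
  -- the edge list never meets them, so they are not enqueued and the
  -- cost does not depend on their number.  The initial cost is for
  -- reading both endpoints of each edge and enqueuing the vertices; the
  -- initial orientation is a placeholder, overwritten on every edge.
  forestsDecompositionOrientation :
    ∀ {n} → MinDegreeRule → Graph n → Comp (Orientation n)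
  forestsDecompositionOrientation {n} rule G = do
    ticks (2 ℕ.* length G ℕ.+ ∣ nonIsolated G ∣)
    peel rule G n (nonIsolated G) 0 (λ _ → true)

  -- Returns the palette size together with the coloring.  Besides the
  -- subroutines, each call pays 1 + |E| for determining the palette size
  -- (leaves) or for writing the combined coloring (inner nodes).
  orientedEdgeColoring :
    ∀ {n} → SplitSubroutine → BaseSubroutine →
    Graph n → Orientation n → (h : ℕ) → Comp (ℕ × (Edge n → ℕ))
  orientedEdgeColoring split base G μ zero = do
    ticks (1 ℕ.+ length G)
    φ ← base G
    return (maxDegree G ℕ.+ 1 , φ)
  orientedEdgeColoring split base G μ (suc h) = do
    (E₁ , E₂) ← split G μ
    (p₁ , φ₁) ← orientedEdgeColoring split base E₁ μ h
    (p₂ , φ₂) ← orientedEdgeColoring split base E₂ μ h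
    ticks (1 ℕ.+ length G)
    return (p₁ ℕ.+ p₂ ,
            λ e → if does (e ∈ₑ? E₁) then φ₁ e else p₁ ℕ.+ φ₂ e)

  arboricityEdgeColoring :
    ∀ {n} → MinDegreeRule → SplitSubroutine → BaseSubroutine →
    Graph n → (h : ℕ) → Comp (ℕ × (Edge n → ℕ))
  arboricityEdgeColoring rule split base G h = do
    μ ← forestsDecompositionOrientation rule G
    orientedEdgeColoring split base G μ h

  -- h = max{⌊log(εα/3)⌋, 0}
  IsDepth : Carrier → ℕ → ℕ → Set
  IsDepth ε α h =
    ∃ λ k → (⌊log₂ ε * fromℕ α ÷ fromℕ 3 ⌋≡ k) × (+ h ≡ k ℤ.⊔ 0ℤ)

module Submission where

open import Defs
open import Data.Nat.Base using (ℕ; NonZero)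
open import Data.Nat.Logarithm using (⌈log₂_⌉)
open import Data.List.Base using (length)
open import Data.Product.Base using (∃; _×_; _,_)
import Data.Nat.Base as ℕ

open import Algebra.Bundles using (CommutativeRing)
import Algebra.Properties.CommutativeMonoid.Sum as Sum
import Algebra.Properties.CommutativeSemigroup as CommutativeSemigroupProperties
import Algebra.Properties.CommutativeSemiring.Exp as Exp
import Algebra.Properties.Ring as RingProperties
import Algebra.Properties.Semiring.Mult as SemiringMult
open import Data.Bool.Base using (true; false; if_then_else_)
open import Data.Fin.Base as Fin using (Fin; zero; suc)
import Data.Fin.Properties as Fin
open import Data.Fin.Subset using (Subset; inside; outside; ∣_∣; ⁅_⁆; Empty)
  renaming (_∈_ to _∈ₛ_; _-_ to _∖_)
open import Data.Fin.Subset.Properties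
  using (nonempty?; x∈p⇒∣p-x∣<∣p∣; x∈p∧x≢y⇒x∈p-y; p─q⊆p; p─q─q≡p─q; ∣p∣≤n)
  renaming (_∈?_ to _∈ₛ?_)
open import Data.Integer.Base using (-[1+_])
import Data.Integer.Base as ℤ
import Data.Integer.Properties as ℤ
open import Data.List.Base using (List; []; _∷_; _++_; map; filter; allFin; lookup)
open import Data.List.Extrema.Nat using (max≤v⁺; xs≤max)
open import Data.List.Membership.Propositional using (_∈_)
open import Data.List.Membership.Propositional.Properties
  using (∈-filter⁻; ∈-filter⁺; ∈-map⁺; ∈-allFin; ∈-lookup; ∈-++⁺ˡ; ∈-++⁺ʳ; ∈-++⁻)
open import Data.List.Properties
  using (length-filter; filter-all; filter-none; filter-accept; filter-reject; filter-some;
         filter-++; length-++; length-map)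
open import Data.List.Relation.Binary.Permutation.Propositional using (_↭_; ↭-sym; ↭⇒↭ₛ)
open import Data.List.Relation.Binary.Permutation.Propositional.Properties
  using (↭-length; filter-↭; All-resp-↭; ∈-resp-↭)
import Data.List.Relation.Binary.Permutation.Setoid.Properties as SetoidPermutation
open import Data.List.Relation.Unary.All as All using (All; []; _∷_)
import Data.List.Relation.Unary.All.Properties as All
open import Data.List.Relation.Unary.AllPairs using ([]; _∷_)
open import Data.List.Relation.Unary.Any as Any using (here; there)
open import Data.List.Relation.Unary.Unique.Propositional using (Unique)
import Data.List.Relation.Unary.Unique.Propositional.Properties as Unique
open import Data.Nat.Base using (zero; suc; z≤n; s≤s)
open import Data.Nat.DivMod using (_/_; _%_; m<n*o⇒m/o<n; m≡m%n+[m/n]*n; m%n<n)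
open import Data.Nat.Logarithm using (⌈log₂⌈n/2⌉⌉≡⌈log₂n⌉∸1; ⌈log₂⌉-mono-≤)
import Data.Nat.Properties as ℕ
open import Data.Nat.Tactic.RingSolver using (solve-∀)
open import Data.Product.Base using (∃₂; proj₁; proj₂; uncurry)
open import Data.Sum.Base using (_⊎_; inj₁; inj₂; [_,_]′)
import Data.Vec.Base as Vec
import Data.Vec.Properties as Vec
open import Function.Base using (_∘_; id)
open import Level using (0ℓ)
open import Relation.Binary.Bundles using (Poset)
open import Relation.Binary.PropositionalEquality using (_≡_; _≢_)
import Relation.Binary.PropositionalEquality as ≡
import Relation.Binary.Reasoning.PartialOrder as PartialOrderReasoning
open import Relation.Binary.Structures using (IsTotalOrder)
open import Relation.Nullary.Decidable using (Dec; yes; no; does; _×-dec_; dec-true; dec-false)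
open import Relation.Nullary.Negation using (¬_; contradiction)
open import Relation.Unary using (Pred; Decidable)

-- Colours: a splitting of discrepancy 1 halves in- and outdegrees up to rounding, so
-- Δ(G₁) + Δ(G₂) ≤ Δ(G) + 2, and by induction the palette has at most Δ + 3·2^h - 2 colours,
-- where 3·2^h ≤ εα unless h = 0.
--
-- Time: the vertex removed in each round of the orientation has degree at most 2α in the
-- remaining graph, so all outdegrees are at most 2α, and at most 2α/2^h + 1 in the leaves of
-- the recursion. Outdegrees at most d force arboricity at most 2d, and 2^h > εα/6, so
-- the leaves have arboricity at most 26/ε. Everything else costs O(2^h + hm), which is
-- O(m log n) because 2^h ≤ α ≤ m ≤ n². Deterministic running times are read off from the
-- expected ones.

-- Colours. A splitting of discrepancy 1 halves every in- and outdegree up to 1/2, so each part has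
-- maximum degree at most Δ/2 + 1 (`maxDegree-split`). For a palette of size p this yields p + 2 ≤ Δ
-- + 3·2^h (`colouring-outcome`): equality holds at a leaf, where p = Δ + 1, and adding the bounds
-- of two parts loses exactly the 2 that is to spare. If h > 0 then 3·2^h ≤ εα by the choice of h;
-- if h = 0 then Δ + 1 ≤ Δ + εα because εα ≥ 1 (`palette≤`).
--
-- Time. The base subroutine is expensive in the arboricity, so the leaves need arboricity O(1/ε). A
-- degree splitting controls arboricity only through outdegrees. A vertex of minimum degree in
-- `G [ A ]` has at most the average degree, hence at most 2α (`minDegree≤2arboricity`), so the
-- computed orientation has outdegrees at most 2α (`forests-outcome`). Splitting halves them at
-- every level (`leafOutdegree≤`), and outdegrees at most d force arboricity at most 2d
-- (`arboricity≤2outdeg`). Since εα ≤ 6·2^h, the leaves have arboricity at most 26/ε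
-- (`leafArboricity≤`).
--
-- The edge sets on one level of the recursion partition E, so the leaves together cost O(m log n /
-- ε^e), where e is the exponent of the arboricity in the time of the base subroutine: 7 or 1. The
-- remaining work is linear in m per level plus a constant per call (`colouring-time`), which is O(m
-- log n) because 2^h ≤ α ≤ m ≤ n². One analysis of expected time covers both versions, since a
-- deterministic computation has its running time as expected time (`E-Deterministic`).

private variable
  n : ℕ
  A B : Set

module Combinatorics where
  open import Data.Nat.Base
    using (_+_; _*_; _∸_; _^_; _≤_; _<_; ⌊_/2⌋; ⌈_/2⌉; ∣_-_∣; >-nonZero)
  open import Data.Nat.Properties
  open import Relation.Binary.PropositionalEquality hiding ([_])
  open Sum +-0-commutativeMonoid using (sum; ∑-distrib-+; sum-cong-≗)

  -- Finite sums and double counting.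

  𝟙 : ∀ {P : Set} → Dec P → ℕ
  𝟙 P? = if does P? then 1 else 0

  sum-mono-≤ : ∀ {f g : Fin n → ℕ} → (∀ i → f i ≤ g i) → sum f ≤ sum g
  sum-mono-≤ {zero}  f≤g = z≤n
  sum-mono-≤ {suc n} f≤g = +-mono-≤ (f≤g zero) (sum-mono-≤ (f≤g ∘ suc))

  sum-zero : ∀ {f : Fin n → ℕ} → (∀ i → f i ≡ 0) → sum f ≡ 0
  sum-zero {zero}  f≡0 = refl
  sum-zero {suc n} f≡0 = cong₂ _+_ (f≡0 zero) (sum-zero (f≡0 ∘ suc))

  sum-point : ∀ (i : Fin n) c → sum (λ j → if does (j Fin.≟ i) then c else 0) ≡ c
  sum-point {suc n} zero    c = trans (cong (c +_) (sum-zero {n} λ _ → refl)) (+-identityʳ c)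
  sum-point (suc i) c = sum-point i c

  sum-pointˡ : ∀ (i : Fin n) c → sum (λ j → if does (i Fin.≟ j) then c else 0) ≡ c
  sum-pointˡ {suc n} zero    c = trans (cong (c +_) (sum-zero {n} λ _ → refl)) (+-identityʳ c)
  sum-pointˡ (suc i) c = sum-pointˡ i c

  sum-subset : ∀ (S : Subset n) c → sum (λ v → if does (v ∈ₛ? S) then c else 0) ≡ ∣ S ∣ * c
  sum-subset Vec.[]                c = refl
  sum-subset (inside  Vec.∷ S) c = cong (c +_) (sum-subset S c)
  sum-subset (outside Vec.∷ S) c = sum-subset S c

  length-filter-∷ : ∀ {P : Pred A 0ℓ} (P? : Decidable P) x xs →
                    length (filter P? (x ∷ xs)) ≡ 𝟙 (P? x) + length (filter P? xs)
  length-filter-∷ P? x xs with does (P? x)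
  ... | true  = refl
  ... | false = refl

  double-counting : ∀ {P : Fin n → Pred A 0ℓ} (P? : ∀ v → Decidable (P v)) k xs →
                    (∀ x → sum (λ v → 𝟙 (P? v x)) ≡ k) →
                    sum (λ v → length (filter (P? v) xs)) ≡ k * length xs
  double-counting {n} P? k []       _    = trans (sum-zero {n} λ _ → refl) (sym (*-zeroʳ k))
  double-counting P? k (x ∷ xs) ∑≡k = begin
    sum (λ v → length (filter (P? v) (x ∷ xs)))             ≡⟨ sum-cong-≗ (λ v → length-filter-∷ (P? v) x xs) ⟩
    sum (λ v → 𝟙 (P? v x) + length (filter (P? v) xs))      ≡⟨ ∑-distrib-+ (λ v → 𝟙 (P? v x)) _ ⟩
    sum (λ v → 𝟙 (P? v x)) + sum (λ v → length (filter (P? v) xs))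
                                                           ≡⟨ cong₂ _+_ (∑≡k x) (double-counting P? k xs ∑≡k) ⟩
    k + k * length xs                                      ≡⟨ *-suc k (length xs) ⟨
    k * length (x ∷ xs)                                    ∎
    where open ≡-Reasoning

  -- Compares degrees in different induced subgraphs of one graph; a trivially true filter stands
  -- for the whole graph. The implication is asked only of elements that pass both filters, so it
  -- also applies to a smaller vertex set when the edges in question survive.
  filter-filter-mono : ∀ {P P′ Q Q′ : Pred A 0ℓ}
    (P? : Decidable P) (P′? : Decidable P′) (Q? : Decidable Q) (Q′? : Decidable Q′) xs →
    (∀ {x} → x ∈ xs → Q x → P x → P′ x × Q′ x) →
    length (filter P? (filter Q? xs)) ≤ length (filter P′? (filter Q′? xs))
  filter-filter-mono P? P′? Q? Q′? []       imp = z≤n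
  filter-filter-mono P? P′? Q? Q′? (x ∷ xs) imp = go (Q? x) (P? x)
    where
    ih : length (filter P? (filter Q? xs)) ≤ length (filter P′? (filter Q′? xs))
    ih = filter-filter-mono P? P′? Q? Q′? xs (imp ∘ there)

    skip : length (filter P′? (filter Q′? xs)) ≤ length (filter P′? (filter Q′? (x ∷ xs)))
    skip with does (Q′? x)
    ... | false = ≤-refl
    ... | true  = ≤-trans (m≤n+m _ _) (≤-reflexive (sym (length-filter-∷ P′? x (filter Q′? xs))))

    go : Dec _ → Dec _ → length (filter P? (filter Q? (x ∷ xs))) ≤ length (filter P′? (filter Q′? (x ∷ xs)))
    go (no ¬q) _ rewrite filter-reject Q? {x} {xs} ¬q = ≤-trans ih skip
    go (yes q) (no ¬p)
      rewrite filter-accept Q? {x} {xs} q | filter-reject P? {x} {filter Q? xs} ¬p = ≤-trans ih skip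
    go (yes q) (yes p) with imp (here refl) q p
    ... | p′ , q′
      rewrite filter-accept Q? {x} {xs} q | filter-accept P? {x} {filter Q? xs} p
            | filter-accept Q′? {x} {xs} q′ | filter-accept P′? {x} {filter Q′? xs} p′ = s≤s ih

  -- Degrees in oriented graphs.

  ∑outdeg≡length : ∀ (G : Graph n) μ → sum (outdeg G μ) ≡ length G
  ∑outdeg≡length G μ = trans
    (double-counting (λ v e → tail μ e Fin.≟ v) 1 G (λ e → sum-pointˡ (tail μ e) 1))
    (*-identityˡ _)

  ∑indeg≡length : ∀ (G : Graph n) μ → sum (indeg G μ) ≡ length G
  ∑indeg≡length G μ = trans
    (double-counting (λ v e → head μ e Fin.≟ v) 1 G (λ e → sum-pointˡ (head μ e) 1))
    (*-identityˡ _)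

  -- The order of the endpoints excludes loops, which would count once on the left and twice on the
  -- right.
  incident≡tail+head : ∀ (μ : Orientation n) (v : Fin n) e → uncurry Fin._<_ e →
                       𝟙 (incident? v e) ≡ 𝟙 (tail μ e Fin.≟ v) + 𝟙 (head μ e Fin.≟ v)
  incident≡tail+head μ v (a , b) a<b with v Fin.≟ a | v Fin.≟ b
  ... | yes refl | yes refl = contradiction a<b (n≮n _)
  ... | yes refl | no v≢b with μ (a , b)
  ...   | true  rewrite dec-true (v Fin.≟ v) refl | dec-false (b Fin.≟ v) (v≢b ∘ sym) = refl
  ...   | false rewrite dec-true (v Fin.≟ v) refl | dec-false (b Fin.≟ v) (v≢b ∘ sym) = refl
  incident≡tail+head μ v (a , b) a<b | no v≢a | yes refl with μ (a , b)
  ...   | true  rewrite dec-true (v Fin.≟ v) refl | dec-false (a Fin.≟ v) (v≢a ∘ sym) = refl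
  ...   | false rewrite dec-true (v Fin.≟ v) refl | dec-false (a Fin.≟ v) (v≢a ∘ sym) = refl
  incident≡tail+head μ v (a , b) a<b | no v≢a | no v≢b with μ (a , b)
  ...   | true  rewrite dec-false (a Fin.≟ v) (v≢a ∘ sym) | dec-false (b Fin.≟ v) (v≢b ∘ sym) = refl
  ...   | false rewrite dec-false (a Fin.≟ v) (v≢a ∘ sym) | dec-false (b Fin.≟ v) (v≢b ∘ sym) = refl

  degree≡outdeg+indeg : ∀ (G : Graph n) μ v → All (uncurry Fin._<_) G →
                        degree G v ≡ outdeg G μ v + indeg G μ v
  degree≡outdeg+indeg []      μ v []            = refl
  degree≡outdeg+indeg (e ∷ G) μ v (e< ∷ G<) = begin
    degree (e ∷ G) v                        ≡⟨ length-filter-∷ (incident? v) e G ⟩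
    𝟙 (incident? v e) + degree G v          ≡⟨ cong₂ _+_ (incident≡tail+head μ v e e<) (degree≡outdeg+indeg G μ v G<) ⟩
    (t + h) + (outdeg G μ v + indeg G μ v)  ≡⟨ interchange t h _ _ ⟩
    (t + outdeg G μ v) + (h + indeg G μ v)  ≡⟨ cong₂ _+_ (length-filter-∷ (λ e → tail μ e Fin.≟ v) e G)
                                                         (length-filter-∷ (λ e → head μ e Fin.≟ v) e G) ⟨
    outdeg (e ∷ G) μ v + indeg (e ∷ G) μ v  ∎
    where
    open ≡-Reasoning
    t = 𝟙 (tail μ e Fin.≟ v)
    h = 𝟙 (head μ e Fin.≟ v)
    interchange : ∀ a b c d → (a + b) + (c + d) ≡ (a + c) + (b + d)
    interchange = solve-∀

  -- Any fixed orientation proves it: outdegrees and indegrees each sum to the number of edges.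
  handshake : ∀ (G : Graph n) → All (uncurry Fin._<_) G → sum (degree G) ≡ 2 * length G
  handshake G G< = begin
    sum (degree G)                         ≡⟨ sum-cong-≗ (λ v → degree≡outdeg+indeg G μ v G<) ⟩
    sum (λ v → outdeg G μ v + indeg G μ v) ≡⟨ ∑-distrib-+ (outdeg G μ) (indeg G μ) ⟩
    sum (outdeg G μ) + sum (indeg G μ)     ≡⟨ cong₂ _+_ (∑outdeg≡length G μ) (∑indeg≡length G μ) ⟩
    length G + length G                    ≡⟨ cong (length G +_) (+-identityʳ _) ⟨
    2 * length G                           ∎
    where
    open ≡-Reasoning
    μ : Orientation _
    μ _ = true

  degree≤maxDegree : ∀ (G : Graph n) v → degree G v ≤ maxDegree G
  degree≤maxDegree G v = All.lookup (xs≤max 0 (map (degree G) (allFin _))) (∈-map⁺ (degree G) (∈-allFin v))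

  maxDegree≤ : ∀ (G : Graph n) {d} → (∀ v → degree G v ≤ d) → maxDegree G ≤ d
  maxDegree≤ G deg≤d = max≤v⁺ z≤n (All.map⁺ (All.universal deg≤d (allFin _)))

  -- Induced subgraphs and arboricity.

  inside? : ∀ (S : Subset n) → Decidable (λ (e : Edge n) → proj₁ e ∈ₛ S × proj₂ e ∈ₛ S)
  inside? S (a , b) = (a ∈ₛ? S) ×-dec (b ∈ₛ? S)

  ∈[]⁻ : ∀ (G : Graph n) (S : Subset n) {e} → e ∈ G [ S ] → e ∈ G × proj₁ e ∈ₛ S × proj₂ e ∈ₛ S
  ∈[]⁻ G S = ∈-filter⁻ (inside? S)

  IsSimple-[] : ∀ (G : Graph n) (S : Subset n) → IsSimple G → IsSimple (G [ S ])
  IsSimple-[] G S (G< , G!) = All.filter⁺ (inside? S) G< , Unique.filter⁺ (inside? S) G!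

  ∈-allSubsets : ∀ (S : Subset n) → S ∈ allSubsets n
  ∈-allSubsets Vec.[]              = here refl
  ∈-allSubsets (inside  Vec.∷ S) = ∈-++⁺ˡ (∈-map⁺ _ (∈-allSubsets S))
  ∈-allSubsets (outside Vec.∷ S) = ∈-++⁺ʳ _ (∈-map⁺ _ (∈-allSubsets S))

  /pred≤ : ∀ {e s b} → 2 ≤ s → e ≤ b * (s ∸ 1) → ⌈ e /pred s ⌉ ≤ b
  /pred≤ {e} {suc (suc k)} {b} (s≤s (s≤s _)) e≤ = ≤-pred (m<n*o⇒m/o<n (begin-strict
    e + k             ≤⟨ +-monoˡ-≤ k e≤ ⟩
    b * suc k + k     <⟨ +-monoʳ-< (b * suc k) (n<1+n k) ⟩
    b * suc k + suc k ≡⟨ +-comm (b * suc k) (suc k) ⟩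
    suc b * suc k     ∎))
    where open ≤-Reasoning

  ≤/pred : ∀ {e s} → 2 ≤ s → e ≤ ⌈ e /pred s ⌉ * (s ∸ 1)
  ≤/pred {e} {suc (suc k)} (s≤s (s≤s _)) = +-cancelʳ-≤ k _ _ (begin
    e + k                                      ≡⟨ m≡m%n+[m/n]*n (e + k) (suc k) ⟩
    (e + k) % suc k + q        ≤⟨ +-monoˡ-≤ q (≤-pred (m%n<n (e + k) (suc k))) ⟩
    k + q                                      ≡⟨ +-comm k q ⟩
    q + k                                      ∎)
    where
    open ≤-Reasoning
    q = (e + k) / suc k * suc k

  -- Together with `arboricity-sparse` this characterises the arboricity as the least b for which
  -- every S with at least two vertices spans at most b(|S| - 1) edges; later arguments use this
  -- form instead of ceilings and maxima.
  arboricity≤ : ∀ (G : Graph n) {b} →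
                (∀ S → 2 ≤ ∣ S ∣ → length (G [ S ]) ≤ b * (∣ S ∣ ∸ 1)) → arboricity G ≤ b
  arboricity≤ {n} G sparse = max≤v⁺ z≤n (All.map⁺ (All.tabulate λ {S} S∈ →
    let 2≤S = proj₂ (∈-filter⁻ (λ S → 2 ≤? ∣ S ∣) {xs = allSubsets n} S∈)
    in /pred≤ 2≤S (sparse S 2≤S)))

  arboricity-sparse : ∀ (G : Graph n) S → 2 ≤ ∣ S ∣ →
                      length (G [ S ]) ≤ arboricity G * (∣ S ∣ ∸ 1)
  arboricity-sparse {n} G S 2≤S = ≤-trans (≤/pred 2≤S) (*-monoˡ-≤ (∣ S ∣ ∸ 1)
    (All.lookup (xs≤max 0 _) (∈-map⁺ _ (∈-filter⁺ (λ S → 2 ≤? ∣ S ∣) (∈-allSubsets S) 2≤S))))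

  arboricity≤length : ∀ (G : Graph n) → arboricity G ≤ length G
  arboricity≤length G = arboricity≤ G λ { S 2≤S → begin
    length (G [ S ])          ≤⟨ length-filter (inside? S) G ⟩
    length G                  ≡⟨ *-identityʳ _ ⟨
    length G * 1              ≤⟨ *-monoʳ-≤ (length G) (∸-monoˡ-≤ 1 2≤S) ⟩
    length G * (∣ S ∣ ∸ 1)    ∎ }
    where open ≤-Reasoning

  ∣S∣≥1 : ∀ {S : Subset n} {v} → v ∈ₛ S → 1 ≤ ∣ S ∣
  ∣S∣≥1 v∈S = ≤-trans (s≤s z≤n) (x∈p⇒∣p-x∣<∣p∣ v∈S)

  -- Sets with fewer than two vertices are outside the maximum that defines arboricity, but they
  -- span no edge, since the endpoints of an edge are distinct.
  length-[]≤arboricity*∣S∣ : ∀ (G : Graph n) S → IsSimple G →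
                            length (G [ S ]) ≤ arboricity G * ∣ S ∣
  length-[]≤arboricity*∣S∣ G S (G< , _) with 2 ≤? ∣ S ∣
  ... | yes 2≤S = ≤-trans (arboricity-sparse G S 2≤S) (*-monoʳ-≤ (arboricity G) (m∸n≤m ∣ S ∣ 1))
  ... | no 2≰S = ≤-trans (≤-reflexive (cong length (filter-none (inside? S) (All.map crossing G<)))) z≤n
    where
    crossing : ∀ {e} → uncurry Fin._<_ e → ¬ (proj₁ e ∈ₛ S × proj₂ e ∈ₛ S)
    crossing {a , b} a<b (a∈S , b∈S) = 2≰S (≤-trans (s≤s (∣S∣≥1 (x∈p∧x≢y⇒x∈p-y a∈S (Fin.<⇒≢ a<b)))) (x∈p⇒∣p-x∣<∣p∣ b∈S))

  -- The minimum is at most the average: |A| times the minimum degree is at most the degree sum,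
  -- which is 2|E(G[A])| ≤ 2α|A|.
  minDegree≤2arboricity : ∀ (G : Graph n) A v → IsSimple G → v ∈ₛ A →
    (∀ {w} → w ∈ₛ A → degree (G [ A ]) v ≤ degree (G [ A ]) w) →
    degree (G [ A ]) v ≤ 2 * arboricity G
  minDegree≤2arboricity G A v simple v∈A minimal = *-cancelˡ-≤ ∣ A ∣ {{>-nonZero (∣S∣≥1 v∈A)}} (begin
    ∣ A ∣ * d                                      ≡⟨ sum-subset A d ⟨
    sum (λ w → if does (w ∈ₛ? A) then d else 0)    ≤⟨ sum-mono-≤ pointwise ⟩
    sum (degree (G [ A ]))                         ≡⟨ handshake (G [ A ]) (proj₁ (IsSimple-[] G A simple)) ⟩
    2 * length (G [ A ])                           ≤⟨ *-monoʳ-≤ 2 (length-[]≤arboricity*∣S∣ G A simple) ⟩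
    2 * (arboricity G * ∣ A ∣)                     ≡⟨ *-assoc 2 (arboricity G) ∣ A ∣ ⟨
    2 * arboricity G * ∣ A ∣                       ≡⟨ *-comm (2 * arboricity G) ∣ A ∣ ⟩
    ∣ A ∣ * (2 * arboricity G)                     ∎)
    where
    open ≤-Reasoning
    d = degree (G [ A ]) v
    pointwise : ∀ w → (if does (w ∈ₛ? A) then d else 0) ≤ degree (G [ A ]) w
    pointwise w with w ∈ₛ? A
    ... | yes w∈A = minimal w∈A
    ... | no  _   = z≤n

  -- Charging each edge of G[S] to its tail gives |E(G[S])| ≤ d |S| ≤ 2d (|S| - 1),
  -- so acyclicity of the orientation is not needed.
  arboricity≤2outdeg : ∀ (G : Graph n) μ {d} → (∀ v → outdeg G μ v ≤ d) → arboricity G ≤ 2 * d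
  arboricity≤2outdeg G μ {d} out≤d = arboricity≤ G λ S 2≤S → begin
    length (G [ S ])                              ≡⟨ ∑outdeg≡length (G [ S ]) μ ⟨
    sum (outdeg (G [ S ]) μ)                      ≤⟨ sum-mono-≤ (pointwise S) ⟩
    sum (λ v → if does (v ∈ₛ? S) then d else 0)   ≡⟨ sum-subset S d ⟩
    ∣ S ∣ * d                                     ≤⟨ *-monoˡ-≤ d (size≤ 2≤S) ⟩
    2 * (∣ S ∣ ∸ 1) * d                           ≡⟨ *-assoc 2 (∣ S ∣ ∸ 1) d ⟩
    2 * ((∣ S ∣ ∸ 1) * d)                         ≡⟨ cong (2 *_) (*-comm (∣ S ∣ ∸ 1) d) ⟩
    2 * (d * (∣ S ∣ ∸ 1))                         ≡⟨ *-assoc 2 d (∣ S ∣ ∸ 1) ⟨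
    2 * d * (∣ S ∣ ∸ 1)                           ∎
    where
    open ≤-Reasoning
    size≤ : ∀ {s} → 2 ≤ s → s ≤ 2 * (s ∸ 1)
    size≤ {suc (suc k)} (s≤s (s≤s _)) = s≤s (≤-trans (m≤n+m (suc k) k)
      (≤-reflexive (cong (k +_) (sym (+-identityʳ (suc k))))))
    tail∈ : ∀ S e → proj₁ e ∈ₛ S × proj₂ e ∈ₛ S → tail μ e ∈ₛ S
    tail∈ S e (a∈S , b∈S) with μ e
    ... | true  = a∈S
    ... | false = b∈S
    pointwise : ∀ S v → outdeg (G [ S ]) μ v ≤ (if does (v ∈ₛ? S) then d else 0)
    pointwise S v with v ∈ₛ? S
    ... | yes _ = ≤-trans sublist (out≤d v)
      where
      sublist : outdeg (G [ S ]) μ v ≤ outdeg G μ v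
      sublist = subst (λ H → outdeg (G [ S ]) μ v ≤ outdeg H μ v)
        (filter-all (λ _ → yes refl) (All.universal (λ _ → refl) G))
        (filter-filter-mono (λ e → tail μ e Fin.≟ v) (λ e → tail μ e Fin.≟ v)
          (inside? S) (λ _ → yes (refl {x = v})) G (λ _ _ t≡v → t≡v , refl))
    ... | no v∉S = ≤-reflexive (cong length (filter-none (λ e → tail μ e Fin.≟ v)
      (All.tabulate λ {e} e∈ → λ { refl → v∉S (tail∈ S e (proj₂ (∈[]⁻ G S e∈))) })))

  -- Numbers of edges and logarithms.

  Unique⇒length≤ : ∀ {k} (xs : List (Fin k)) → Unique xs → length xs ≤ k
  Unique⇒length≤ xs xs! = Fin.injective⇒≤ (lookup-injective xs xs!)
    where
    lookup-injective : ∀ xs → Unique xs → ∀ {i j : Fin (length xs)} → lookup xs i ≡ lookup xs j → i ≡ j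
    lookup-injective (x ∷ xs) (x∉ ∷ xs!) {zero}  {zero}  eq = refl
    lookup-injective (x ∷ xs) (x∉ ∷ xs!) {zero}  {suc j} eq = contradiction eq (All.lookup x∉ (∈-lookup j))
    lookup-injective (x ∷ xs) (x∉ ∷ xs!) {suc i} {zero}  eq = contradiction (sym eq) (All.lookup x∉ (∈-lookup i))
    lookup-injective (x ∷ xs) (x∉ ∷ xs!) {suc i} {suc j} eq = cong suc (lookup-injective xs xs! eq)

  length≤n² : ∀ (G : Graph n) → IsSimple G → length G ≤ n * n
  length≤n² G (_ , G!) = subst (_≤ _) (length-map (uncurry Fin.combine) G)
    (Unique⇒length≤ _ (Unique.map⁺ injective G!))
    where
    injective : ∀ {e f : Edge _} → uncurry Fin.combine e ≡ uncurry Fin.combine f → e ≡ f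
    injective {a , b} {c , d} eq with Fin.combine-injective a b c d eq
    ... | refl , refl = refl

  n≤2*⌈n/2⌉ : ∀ n → n ≤ 2 * ⌈ n /2⌉
  n≤2*⌈n/2⌉ n = begin
    n                     ≡⟨ ⌊n/2⌋+⌈n/2⌉≡n n ⟨
    ⌊ n /2⌋ + ⌈ n /2⌉     ≤⟨ +-monoˡ-≤ ⌈ n /2⌉ (⌊n/2⌋≤⌈n/2⌉ n) ⟩
    ⌈ n /2⌉ + ⌈ n /2⌉     ≡⟨ cong (⌈ n /2⌉ +_) (+-identityʳ _) ⟨
    2 * ⌈ n /2⌉           ∎
    where open ≤-Reasoning

  -- Induction on k: passing from n to its rounded-up half lowers the logarithm by one and at most
  -- halves n.
  ⌈log₂n⌉≤k⇒n≤2^k : ∀ n k → ⌈log₂ n ⌉ ≤ k → n ≤ 2 ^ k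
  ⌈log₂n⌉≤k⇒n≤2^k n zero    L≤0 = ≮⇒≥ λ 1<n → contradiction (≤-trans (⌈log₂⌉-mono-≤ 1<n) L≤0) λ ()
  ⌈log₂n⌉≤k⇒n≤2^k n (suc k) L≤  = ≤-trans (n≤2*⌈n/2⌉ n) (*-monoʳ-≤ 2 (⌈log₂n⌉≤k⇒n≤2^k ⌈ n /2⌉ k
    (subst (_≤ k) (sym (⌈log₂⌈n/2⌉⌉≡⌈log₂n⌉∸1 n)) (∸-monoˡ-≤ 1 L≤))))

  -- Removing a vertex: effect on the orientation, and cost.

  v∉A∖v : ∀ (A : Subset n) v → ¬ (v ∈ₛ A ∖ v)
  v∉A∖v A v v∈ = <-irrefl (cong ∣_∣ (p─q─q≡p─q A ⁅ v ⁆)) (x∈p⇒∣p-x∣<∣p∣ v∈)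

  -- Hence the direction an edge receives when its first endpoint is removed is never overwritten by
  -- later rounds.
  orientFrom-outside : ∀ {v : Fin n} {A} μ e → v ∈ₛ A → ¬ (proj₁ e ∈ₛ A × proj₂ e ∈ₛ A) →
                       orientFrom v A μ e ≡ μ e
  orientFrom-outside {v = v} {A} μ (a , b) v∈A ¬ab
    with v Fin.≟ a | b ∈ₛ? A | v Fin.≟ b | a ∈ₛ? A
  ... | yes refl | yes b∈A | _        | _       = contradiction (v∈A , b∈A) ¬ab
  ... | yes refl | no  b∉A | yes refl | _       = contradiction v∈A b∉A
  ... | yes refl | no  _   | no _     | _       = refl
  ... | no _     | _       | yes refl | yes a∈A = contradiction (a∈A , v∈A) ¬ab
  ... | no _     | _       | yes refl | no _    = refl
  ... | no _     | _       | no _     | _       = refl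

  orientFrom-tail : ∀ {v : Fin n} {A} μ e → Incident v e → proj₁ e ∈ₛ A × proj₂ e ∈ₛ A →
                    tail (orientFrom v A μ) e ≡ v
  orientFrom-tail {v = v} {A} μ (a , b) inc (a∈A , b∈A)
    rewrite dec-true (b ∈ₛ? A) b∈A | dec-true (a ∈ₛ? A) a∈A with v Fin.≟ a | v Fin.≟ b | inc
  ... | yes refl | _        | _        = refl
  ... | no _     | yes refl | _        = refl
  ... | no v≢a   | no _     | inj₁ v≡a = contradiction v≡a v≢a
  ... | no _     | no v≢b   | inj₂ v≡b = contradiction v≡b v≢b

  tail-cong : ∀ {μ ν : Orientation n} e → μ e ≡ ν e → tail μ e ≡ tail ν e
  tail-cong e = cong (if_then proj₁ e else proj₂ e)

  -- Potential for the running time: the round that removes `v` spends at most 1 + deg(v) steps on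
  -- the bucket search and deg(v) on scanning edges. Its sum over `A` pays for all remaining rounds.
  peelCost : Graph n → Subset n → Fin n → ℕ
  peelCost G A v = if does (v ∈ₛ? A) then 1 + 2 * degree G v else 0

  ∑peelCost-∖ : ∀ (G : Graph n) {A v} → v ∈ₛ A →
                (1 + 2 * degree G v) + sum (peelCost G (A ∖ v)) ≤ sum (peelCost G A)
  ∑peelCost-∖ G {A} {v} v∈A = begin
    c + sum (peelCost G (A ∖ v))
      ≡⟨ cong (_+ sum (peelCost G (A ∖ v))) (sum-point v c) ⟨
    sum (λ u → if does (u Fin.≟ v) then c else 0) + sum (peelCost G (A ∖ v))
      ≡⟨ ∑-distrib-+ (λ u → if does (u Fin.≟ v) then c else 0) (peelCost G (A ∖ v)) ⟨
    sum (λ u → (if does (u Fin.≟ v) then c else 0) + peelCost G (A ∖ v) u)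
      ≤⟨ sum-mono-≤ pointwise ⟩
    sum (peelCost G A)
      ∎
    where
    open ≤-Reasoning
    c = 1 + 2 * degree G v
    pointwise : ∀ u → (if does (u Fin.≟ v) then c else 0) + peelCost G (A ∖ v) u ≤ peelCost G A u
    pointwise u with u Fin.≟ v
    ... | yes refl rewrite dec-true (v ∈ₛ? A) v∈A | dec-false (v ∈ₛ? (A ∖ v)) (v∉A∖v A v) =
      ≤-reflexive (+-identityʳ c)
    ... | no u≢v with u ∈ₛ? (A ∖ v)
    ...   | no _ = z≤n
    ...   | yes u∈ rewrite dec-true (u ∈ₛ? A) (p─q⊆p A ⁅ v ⁆ u∈) = ≤-refl

  ∈-nonIsolated : ∀ (G : Graph n) {v} → 1 ≤ degree G v → v ∈ₛ nonIsolated G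
  ∈-nonIsolated G {v} 1≤deg = Vec.lookup⇒[]= v _
    (trans (Vec.lookup∘tabulate _ v) (dec-true (1 ≤? degree G v) 1≤deg))

  ∈-nonIsolated⁻ : ∀ (G : Graph n) {v} → v ∈ₛ nonIsolated G → 1 ≤ degree G v
  ∈-nonIsolated⁻ G {v} v∈ = does-true (1 ≤? degree G v)
    (trans (sym (Vec.lookup∘tabulate _ v)) (Vec.[]=⇒lookup v∈))
    where
    does-true : ∀ {P : Set} (P? : Dec P) → does P? ≡ true → P
    does-true (yes p) _ = p

  -- Turns the outdegree bound for the graph induced on the initial vertex set into a bound for `G`
  -- itself.
  [nonIsolated] : ∀ (G : Graph n) → G [ nonIsolated G ] ≡ G
  [nonIsolated] G = filter-all (inside? (nonIsolated G)) (All.tabulate λ e∈G →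
    endpoint e∈G (inj₁ refl) , endpoint e∈G (inj₂ refl))
    where
    endpoint : ∀ {v e} → e ∈ G → Incident v e → v ∈ₛ nonIsolated G
    endpoint {v} e∈G inc = ∈-nonIsolated G (filter-some (incident? v) (Any.map (λ { refl → inc }) e∈G))

  ∣nonIsolated∣≤ : ∀ (G : Graph n) → IsSimple G → ∣ nonIsolated G ∣ ≤ 2 * length G
  ∣nonIsolated∣≤ G (G< , _) = begin
    ∣ S ∣                                        ≡⟨ *-identityʳ ∣ S ∣ ⟨
    ∣ S ∣ * 1                                    ≡⟨ sum-subset S 1 ⟨
    sum (λ v → if does (v ∈ₛ? S) then 1 else 0)  ≤⟨ sum-mono-≤ pointwise ⟩
    sum (degree G)                               ≡⟨ handshake G G< ⟩
    2 * length G                                 ∎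
    where
    open ≤-Reasoning
    S = nonIsolated G
    pointwise : ∀ v → (if does (v ∈ₛ? S) then 1 else 0) ≤ degree G v
    pointwise v with v ∈ₛ? S
    ... | yes v∈S = ∈-nonIsolated⁻ G v∈S
    ... | no  _   = z≤n

  -- Enqueued vertices have degree at least 1, so 1 + 2 deg ≤ 3 deg, and the degrees sum to 2m.
  ∑peelCost≤ : ∀ (G : Graph n) → IsSimple G → sum (peelCost G (nonIsolated G)) ≤ 6 * length G
  ∑peelCost≤ G (G< , _) = begin
    sum (peelCost G S)                                     ≤⟨ sum-mono-≤ pointwise ⟩
    sum (λ v → degree G v + (degree G v + degree G v))     ≡⟨ ∑-distrib-+ (degree G) _ ⟩
    sum (degree G) + sum (λ v → degree G v + degree G v)   ≡⟨ cong (sum (degree G) +_) (∑-distrib-+ (degree G) _) ⟩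
    sum (degree G) + (sum (degree G) + sum (degree G))     ≡⟨ cong (λ s → s + (s + s)) (handshake G G<) ⟩
    2 * length G + (2 * length G + 2 * length G)           ≡⟨ six (length G) ⟩
    6 * length G                                           ∎
    where
    open ≤-Reasoning
    S = nonIsolated G
    six : ∀ m → 2 * m + (2 * m + 2 * m) ≡ 6 * m
    six = solve-∀
    pointwise : ∀ v → peelCost G S v ≤ degree G v + (degree G v + degree G v)
    pointwise v with v ∈ₛ? S
    ... | yes v∈S = +-mono-≤ (∈-nonIsolated⁻ G v∈S) (+-monoʳ-≤ (degree G v) (≤-reflexive (+-identityʳ _)))
    ... | no  _   = z≤n

  -- Halving degrees by an oriented splitting.

  double≤⇒≤half : ∀ {a b} → 2 * a ≤ b → a ≤ ⌊ b /2⌋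
  double≤⇒≤half {a} {b} 2a≤b = ≤-trans (≤-reflexive (n≡⌊n+n/2⌋ a))
    (⌊n/2⌋-mono (≤-trans (≤-reflexive (cong (a +_) (sym (+-identityʳ a)))) 2a≤b))

  2*⌊n/2⌋≤n : ∀ n → 2 * ⌊ n /2⌋ ≤ n
  2*⌊n/2⌋≤n n = begin
    2 * ⌊ n /2⌋         ≡⟨ cong (⌊ n /2⌋ +_) (+-identityʳ _) ⟩
    ⌊ n /2⌋ + ⌊ n /2⌋   ≤⟨ +-monoʳ-≤ ⌊ n /2⌋ (⌊n/2⌋≤⌈n/2⌉ n) ⟩
    ⌊ n /2⌋ + ⌈ n /2⌉   ≡⟨ ⌊n/2⌋+⌈n/2⌉≡n n ⟩
    n                   ∎
    where open ≤-Reasoning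

  discrepancy⇒half : ∀ a b {s} → a + b ≡ s → ∣ a - b ∣ ≤ 1 → (2 * a ≤ suc s) × (2 * b ≤ suc s)
  discrepancy⇒half a b refl ∣a-b∣≤1 = left , right
    where
    open ≤-Reasoning
    left : 2 * a ≤ suc (a + b)
    left = begin
      2 * a                   ≡⟨ cong (a +_) (+-identityʳ a) ⟩
      a + a                   ≤⟨ +-monoʳ-≤ a (m≤n+∣m-n∣ a b) ⟩
      a + (b + ∣ a - b ∣)     ≤⟨ +-monoʳ-≤ a (+-monoʳ-≤ b ∣a-b∣≤1) ⟩
      a + (b + 1)             ≡⟨ shift a b ⟩
      suc (a + b)             ∎
      where
      shift : ∀ a b → a + (b + 1) ≡ suc (a + b)
      shift = solve-∀
    right : 2 * b ≤ suc (a + b)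
    right = begin
      2 * b                   ≡⟨ cong (b +_) (+-identityʳ b) ⟩
      b + b                   ≤⟨ +-monoʳ-≤ b (m≤n+∣n-m∣ b a) ⟩
      b + (a + ∣ a - b ∣)     ≤⟨ +-monoʳ-≤ b (+-monoʳ-≤ a ∣a-b∣≤1) ⟩
      b + (a + 1)             ≡⟨ shift a b ⟩
      suc (a + b)             ∎
      where
      shift : ∀ a b → b + (a + 1) ≡ suc (a + b)
      shift = solve-∀

  module Splitting (G E₁ E₂ : Graph n) (μ : Orientation n) (simple : IsSimple G)
                   (splitting : IsOrientedDegreeSplitting G μ 1 (E₁ , E₂)) where

    private
      perm : E₁ ++ E₂ ↭ G
      perm = proj₁ splitting

      count : ∀ {P : Pred (Edge n) 0ℓ} (P? : Decidable P) →
              length (filter P? E₁) + length (filter P? E₂) ≡ length (filter P? G)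
      count P? = begin
        length (filter P? E₁) + length (filter P? E₂) ≡⟨ length-++ (filter P? E₁) ⟨
        length (filter P? E₁ ++ filter P? E₂)         ≡⟨ cong length (filter-++ P? E₁ E₂) ⟨
        length (filter P? (E₁ ++ E₂))                 ≡⟨ ↭-length (filter-↭ P? perm) ⟩
        length (filter P? G)                          ∎
        where open ≡-Reasoning

      out-half : ∀ v → (2 * outdeg E₁ μ v ≤ suc (outdeg G μ v)) × (2 * outdeg E₂ μ v ≤ suc (outdeg G μ v))
      out-half v = discrepancy⇒half (outdeg E₁ μ v) (outdeg E₂ μ v) (count (λ e → tail μ e Fin.≟ v)) (proj₂ (proj₂ splitting v))

      in-half : ∀ v → (2 * indeg E₁ μ v ≤ suc (indeg G μ v)) × (2 * indeg E₂ μ v ≤ suc (indeg G μ v))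
      in-half v = discrepancy⇒half (indeg E₁ μ v) (indeg E₂ μ v) (count (λ e → head μ e Fin.≟ v)) (proj₁ (proj₂ splitting v))

      all : All (uncurry Fin._<_) (E₁ ++ E₂)
      all = All-resp-↭ (↭-sym perm) (proj₁ simple)

      unique : Unique (E₁ ++ E₂)
      unique = SetoidPermutation.Unique-resp-↭ (setoid (Edge n)) (↭⇒↭ₛ (↭-sym perm)) (proj₂ simple)

      unique-++⁻ : ∀ (xs : List A) {ys} → Unique (xs ++ ys) → Unique xs × Unique ys
      unique-++⁻ []       ys! = [] , ys!
      unique-++⁻ (x ∷ xs) (x∉ ∷ u) = (All.++⁻ˡ xs x∉ ∷ proj₁ (unique-++⁻ xs u)) , proj₂ (unique-++⁻ xs u)

    length-split : length E₁ + length E₂ ≡ length G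
    length-split = trans (sym (length-++ E₁)) (↭-length perm)

    simple₁ : IsSimple E₁
    simple₁ = All.++⁻ˡ E₁ all , proj₁ (unique-++⁻ E₁ unique)

    simple₂ : IsSimple E₂
    simple₂ = All.++⁻ʳ E₁ all , proj₂ (unique-++⁻ E₁ unique)

    -- Discrepancy 1 gives 2·outdeg ≤ d + 1, and `⌈ d /2⌉` is by definition `⌊ suc d /2⌋`.
    outdeg-split : ∀ {d} → (∀ v → outdeg G μ v ≤ d) →
                   (∀ v → outdeg E₁ μ v ≤ ⌈ d /2⌉) × (∀ v → outdeg E₂ μ v ≤ ⌈ d /2⌉)
    outdeg-split out≤d =
      (λ v → double≤⇒≤half (≤-trans (proj₁ (out-half v)) (s≤s (out≤d v)))) ,
      (λ v → double≤⇒≤half (≤-trans (proj₂ (out-half v)) (s≤s (out≤d v))))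

    -- The two maxima may be attained at different vertices, so each is bounded separately by half
    -- of Δ + 2. The 2 collects the rounding of the outdegree and that of the indegree.
    maxDegree-split : maxDegree E₁ + maxDegree E₂ ≤ maxDegree G + 2
    maxDegree-split = begin
      maxDegree E₁ + maxDegree E₂               ≤⟨ +-mono-≤ (half E₁ (proj₁ simple₁) (proj₁ ∘ out-half) (proj₁ ∘ in-half))
                                                            (half E₂ (proj₁ simple₂) (proj₂ ∘ out-half) (proj₂ ∘ in-half)) ⟩
      ⌊ maxDegree G + 2 /2⌋ + ⌊ maxDegree G + 2 /2⌋ ≡⟨ cong (⌊ maxDegree G + 2 /2⌋ +_) (+-identityʳ _) ⟨
      2 * ⌊ maxDegree G + 2 /2⌋                 ≤⟨ 2*⌊n/2⌋≤n _ ⟩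
      maxDegree G + 2                           ∎
      where
      open ≤-Reasoning
      half : ∀ E → All (uncurry Fin._<_) E →
             (∀ v → 2 * outdeg E μ v ≤ suc (outdeg G μ v)) → (∀ v → 2 * indeg E μ v ≤ suc (indeg G μ v)) →
             maxDegree E ≤ ⌊ maxDegree G + 2 /2⌋
      half E E< out in′ = maxDegree≤ E λ v → double≤⇒≤half (begin
        2 * degree E v                            ≡⟨ cong (2 *_) (degree≡outdeg+indeg E μ v E<) ⟩
        2 * (outdeg E μ v + indeg E μ v)          ≡⟨ *-distribˡ-+ 2 (outdeg E μ v) _ ⟩
        2 * outdeg E μ v + 2 * indeg E μ v        ≤⟨ +-mono-≤ (out v) (in′ v) ⟩
        suc (outdeg G μ v) + suc (indeg G μ v)    ≡⟨ shift (outdeg G μ v) (indeg G μ v) ⟩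
        (outdeg G μ v + indeg G μ v) + 2          ≡⟨ cong (_+ 2) (degree≡outdeg+indeg G μ v (proj₁ simple)) ⟨
        degree G v + 2                            ≤⟨ +-monoˡ-≤ 2 (degree≤maxDegree G v) ⟩
        maxDegree G + 2                           ∎)
        where
        shift : ∀ a b → suc a + suc b ≡ (a + b) + 2
        shift = solve-∀

    proper-split : ∀ {p₁ p₂ φ₁ φ₂} → ProperEdgeColoring E₁ p₁ φ₁ → ProperEdgeColoring E₂ p₂ φ₂ →
      ProperEdgeColoring G (p₁ + p₂) (λ e → if does (e ∈ₑ? E₁) then φ₁ e else p₁ + φ₂ e)
    proper-split {p₁} {p₂} {φ₁} {φ₂} (range₁ , proper₁) (range₂ , proper₂) = range , proper
      where
      φ = λ e → if does (e ∈ₑ? E₁) then φ₁ e else p₁ + φ₂ e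

      in₂ : ∀ {e} → e ∈ G → ¬ (e ∈ E₁) → e ∈ E₂
      in₂ e∈G e∉E₁ = [ (λ e∈E₁ → contradiction e∈E₁ e∉E₁) , id ]′ (∈-++⁻ E₁ (∈-resp-↭ (↭-sym perm) e∈G))

      -- Colours start at 1, so the shifted palette lies strictly above `p₁`.
      apart : ∀ {e f} → e ∈ E₁ → f ∈ E₂ → φ₁ e ≢ p₁ + φ₂ f
      apart {e} {f} e∈ f∈ eq = <⇒≢ (begin-strict
        φ₁ e          ≤⟨ proj₂ (range₁ e∈) ⟩
        p₁            <⟨ m<m+n p₁ (proj₁ (range₂ f∈)) ⟩
        p₁ + φ₂ f     ∎) eq
        where open ≤-Reasoning

      range : ∀ {e} → e ∈ G → (1 ≤ φ e) × (φ e ≤ p₁ + p₂)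
      range {e} e∈G with e ∈ₑ? E₁
      ... | yes e∈ = proj₁ (range₁ e∈) , ≤-trans (proj₂ (range₁ e∈)) (m≤m+n p₁ p₂)
      ... | no  e∉ = ≤-trans (proj₁ (range₂ (in₂ e∈G e∉))) (m≤n+m _ p₁) ,
                     +-monoʳ-≤ p₁ (proj₂ (range₂ (in₂ e∈G e∉)))

      proper : ∀ {e f} → e ∈ G → f ∈ G → e ≢ f → (∃ λ v → Incident v e × Incident v f) → φ e ≢ φ f
      proper {e} {f} e∈G f∈G e≢f meet with e ∈ₑ? E₁ | f ∈ₑ? E₁
      ... | yes e∈ | yes f∈ = proper₁ e∈ f∈ e≢f meet
      ... | yes e∈ | no  f∉ = apart e∈ (in₂ f∈G f∉)
      ... | no  e∉ | yes f∈ = apart f∈ (in₂ e∈G e∉) ∘ sym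
      ... | no  e∉ | no  f∉ = proper₂ (in₂ e∈G e∉) (in₂ f∈G f∉) e≢f meet ∘ +-cancelˡ-≡ p₁ _ _

  -- Recurrences for leaf outdegree and running time.

  leafOutdegree : (d h : ℕ) → ℕ
  leafOutdegree d zero    = d
  leafOutdegree d (suc h) = leafOutdegree ⌈ d /2⌉ h

  -- The `suc` strengthens the induction hypothesis: rounding `⌈ d /2⌉` up can add one on the right,
  -- and doubling the `suc` supplies one on the left.
  leafOutdegree≤ : ∀ d h → suc (2 ^ h * leafOutdegree d h) ≤ d + 2 ^ h
  leafOutdegree≤ d zero    = ≤-reflexive (trans (cong suc (*-identityˡ d)) (+-comm 1 d))
  leafOutdegree≤ d (suc h) = ≤-pred (begin
    suc (suc (2 * 2 ^ h * ℓ))   ≡⟨ expand (2 ^ h) ℓ ⟩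
    2 * suc (2 ^ h * ℓ)         ≤⟨ *-monoʳ-≤ 2 (leafOutdegree≤ ⌈ d /2⌉ h) ⟩
    2 * (⌈ d /2⌉ + 2 ^ h)       ≡⟨ *-distribˡ-+ 2 ⌈ d /2⌉ (2 ^ h) ⟩
    2 * ⌈ d /2⌉ + 2 * 2 ^ h     ≤⟨ +-monoˡ-≤ (2 * 2 ^ h) (2*⌊n/2⌋≤n (suc d)) ⟩
    suc d + 2 * 2 ^ h           ∎)
    where
    open ≤-Reasoning
    ℓ = leafOutdegree ⌈ d /2⌉ h
    expand : ∀ a ℓ → suc (suc (2 * a * ℓ)) ≡ 2 * suc (a * ℓ)
    expand = solve-∀

  leafCost≤ : ∀ c s m L {a X} → a ≤ X →
    (1 + m) + (c * (1 + m * a * L) + 0) + (c + s + 1) ≤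
    (c + s + 1) * (2 * 1 + 1 * m) + c * m * L * X
  leafCost≤ c s m L {a} {X} a≤X = begin
    cost a                                ≤⟨ +-monoˡ-≤ (c + s + 1) (+-monoʳ-≤ (1 + m) (+-monoˡ-≤ 0
                                               (*-monoʳ-≤ c (+-monoʳ-≤ 1 (*-monoˡ-≤ L (*-monoʳ-≤ m a≤X)))))) ⟩
    cost X                                ≤⟨ m≤m+n _ _ ⟩
    cost X + (s + (c + s) * m)    ≡⟨ rearrange c s m L X ⟩
    _                                     ∎
    where
    open ≤-Reasoning
    cost : ℕ → ℕ
    cost a = (1 + m) + (c * (1 + m * a * L) + 0) + (c + s + 1)
    rearrange : ∀ c s m L X →
      (1 + m) + (c * (1 + m * X * L) + 0) + (c + s + 1) + (s + (c + s) * m) ≡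
      (c + s + 1) * (2 * 1 + 1 * m) + c * m * L * X
    rearrange = solve-∀

  -- Of the two slacks K of the subcalls, one pays for the constant part of this call and one is
  -- handed on; the new level of the recursion contributes K·m, which pays for the part linear in m.
  innerCost≤ : ∀ c s L X b h {m m₁ m₂ t w₁ w₂} → let K = c + s + 1 in
    m₁ + m₂ ≡ m → t ≤ s * (1 + m) →
    w₁ + K ≤ K * (2 * b + h * m₁) + c * m₁ * L * X →
    w₂ + K ≤ K * (2 * b + h * m₂) + c * m₂ * L * X →
    t + (w₁ + (w₂ + (1 + m + 0))) + K ≤
    K * (2 * (2 * b) + suc h * m) + c * m * L * X
  innerCost≤ c s L X b h {m} {m₁} {m₂} {t} {w₁} {w₂} refl t≤ w₁≤ w₂≤ = begin
    t + (w₁ + (w₂ + (1 + m + 0))) + (c + s + 1)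
      ≤⟨ +-monoˡ-≤ _ (+-monoˡ-≤ _ t≤) ⟩
    s * (1 + m) + (w₁ + (w₂ + (1 + m + 0))) + (c + s + 1)
      ≤⟨ m≤m+n _ (c * (1 + m)) ⟩
    s * (1 + m) + (w₁ + (w₂ + (1 + m + 0))) + (c + s + 1) + c * (1 + m)
      ≡⟨ group c s m w₁ w₂ ⟩
    (w₁ + (c + s + 1)) + (w₂ + (c + s + 1)) + (c + s + 1) * m
      ≤⟨ +-monoˡ-≤ _ (+-mono-≤ w₁≤ w₂≤) ⟩
    _
      ≡⟨ collect (c + s + 1) c L X b h m₁ m₂ ⟩
    _ ∎
    where
    open ≤-Reasoning
    group : ∀ c s m w₁ w₂ →
      s * (1 + m) + (w₁ + (w₂ + (1 + m + 0))) + (c + s + 1) + c * (1 + m) ≡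
      (w₁ + (c + s + 1)) + (w₂ + (c + s + 1)) + (c + s + 1) * m
    group = solve-∀
    collect : ∀ K c L X b h m₁ m₂ →
      (K * (2 * b + h * m₁) + c * m₁ * L * X) +
      (K * (2 * b + h * m₂) + c * m₂ * L * X) + K * (m₁ + m₂) ≡
      K * (2 * (2 * b) + (1 + h) * (m₁ + m₂)) + c * (m₁ + m₂) * L * X
    collect = solve-∀

  -- The factor 5 is 2 + 3: 2 from b ≤ m ≤ mL and 3 from h + 1 ≤ 3L. The 10m is the cost of the
  -- orientation.
  lowOrderCost≤ : ∀ K m L b h → b ≤ m → h ≤ L + L → 1 ≤ L →
    10 * m + K * (2 * b + suc h * m) ≤ (10 + 5 * K) * (m * L)
  lowOrderCost≤ K m L b h b≤m h≤2L 1≤L = begin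
    10 * m + K * (2 * b + suc h * m)
      ≤⟨ +-mono-≤ (*-monoʳ-≤ 10 m≤mL) (*-monoʳ-≤ K (+-mono-≤ (*-monoʳ-≤ 2 (≤-trans b≤m m≤mL))
           (*-monoˡ-≤ m (+-mono-≤ 1≤L h≤2L)))) ⟩
    10 * (m * L) + K * (2 * (m * L) + (L + (L + L)) * m)
      ≡⟨ collect K m L ⟩
    (10 + 5 * K) * (m * L)
      ∎
    where
    open ≤-Reasoning
    m≤mL : m ≤ m * L
    m≤mL = ≤-trans (≤-reflexive (sym (*-identityʳ m))) (*-monoʳ-≤ m 1≤L)
    collect : ∀ K m L → 10 * (m * L) + K * (2 * (m * L) + (L + (L + L)) * m) ≡
                        (10 + 5 * K) * (m * L)
    collect = solve-∀

  1≤⌈log₂n⌉ : ∀ (G : Graph n) → IsSimple G → 1 ≤ length G → 1 ≤ ⌈log₂ n ⌉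
  1≤⌈log₂n⌉ {n} ((a , b) ∷ _) (a<b ∷ _ , _) _ =
    ⌈log₂⌉-mono-≤ {2} (≤-trans (s≤s (≤-trans (s≤s z≤n) a<b)) (Fin.toℕ<n b))

  -- Otherwise 2^h would exceed 2^(2L) ≥ n² ≥ m. This makes the number of levels of the recursion
  -- O(log n).
  depth≤2⌈log₂n⌉ : ∀ (G : Graph n) {h} → IsSimple G → 2 ^ h ≤ length G → h ≤ ⌈log₂ n ⌉ + ⌈log₂ n ⌉
  depth≤2⌈log₂n⌉ {n} G {h} simple 2^h≤m = ≮⇒≥ λ 2L<h → <⇒≱ (^-monoʳ-< 2 (s≤s (s≤s z≤n)) 2L<h) (begin
    2 ^ h                   ≤⟨ 2^h≤m ⟩
    length G                  ≤⟨ length≤n² G simple ⟩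
    n * n                   ≤⟨ *-mono-≤ n≤2^L n≤2^L ⟩
    2 ^ L * 2 ^ L       ≡⟨ ^-distribˡ-+-* 2 L L ⟨
    2 ^ (L + L)           ∎)
    where
    open ≤-Reasoning
    L = ⌈log₂ n ⌉
    n≤2^L : n ≤ 2 ^ L
    n≤2^L = ⌈log₂n⌉≤k⇒n≤2^k n L ≤-refl

open Combinatorics

-- Outcomes and determinism of computations.

module Outcomes (F : OrderedField) where
  open Algorithms F
  open import Data.Nat.Base using (_+_; _*_; _∸_; _^_; _≤_)
  open import Data.Nat.Properties
  open import Relation.Binary.PropositionalEquality hiding ([_])
  open Sum +-0-commutativeMonoid using (sum)

  ⇓->>=⁻ : ∀ (c : Comp A) {f : A → Comp B} {b t} → (c >>= f) ⇓ b # t →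
           ∃ λ a → ∃₂ λ t₁ t₂ → (c ⇓ a # t₁) × (f a ⇓ b # t₂) × (t ≡ t₁ + t₂)
  ⇓->>=⁻ (return a) r = a , 0 , _ , return , r , refl
  ⇓->>=⁻ (tick c) (tick r) with ⇓->>=⁻ c r
  ... | a , t₁ , t₂ , r₁ , r₂ , refl = a , suc t₁ , t₂ , tick r₁ , r₂ , refl
  ⇓->>=⁻ (draw d k) (draw i w r) with ⇓->>=⁻ (k i) r
  ... | a , t₁ , t₂ , r₁ , r₂ , refl = a , t₁ , t₂ , draw i w r₁ , r₂ , refl

  ⇓-ticks⁻ : ∀ s {c : Comp A} {a t} → (ticks s >> c) ⇓ a # t → ∃ λ t′ → (c ⇓ a # t′) × (t ≡ s + t′)
  ⇓-ticks⁻ zero    r        = _ , r , refl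
  ⇓-ticks⁻ (suc s) (tick r) with ⇓-ticks⁻ s r
  ... | t′ , r′ , refl = t′ , r′ , refl

  -- The continuation is tested only on outcomes of `c`: the parts returned by the splitting
  -- subroutine are known to be simple only because they are outcomes.
  Deterministic->>= : ∀ {c : Comp A} {f : A → Comp B} → Deterministic c →
                      (∀ {a t} → c ⇓ a # t → Deterministic (f a)) → Deterministic (c >>= f)
  Deterministic->>= return   df = df return
  Deterministic->>= (tick dc) df = tick (Deterministic->>= dc (df ∘ tick))

  Deterministic-ticks : ∀ s {c : Comp A} → Deterministic c → Deterministic (ticks s >> c)
  Deterministic-ticks zero    dc = dc
  Deterministic-ticks (suc s) dc = tick (Deterministic-ticks s dc)

  outcome : ∀ {c : Comp A} → Deterministic c → ∃₂ λ a t → c ⇓ a # t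
  outcome return    = _ , _ , return
  outcome (tick dc) with outcome dc
  ... | a , t , r = a , suc t , tick r

  -- The orientation obtained by peeling off vertices of minimum degree.

  module _ (rule : MinDegreeRule) (G : Graph n) where

    Deterministic-peel : ∀ rounds A d μ → Deterministic (peel rule G rounds A d μ)
    Deterministic-peel zero           A d μ = return
    Deterministic-peel (suc rounds) A d μ with nonempty? A
    ... | no  _   = return
    ... | yes A≢∅ = Deterministic-ticks (suc d′ ∸ (d ∸ 1)) (Deterministic-ticks (degree G v)
                      (Deterministic-peel rounds (A ∖ v) d′ (orientFrom v A μ)))
      where
      v = proj₁ (rule G A A≢∅)
      d′ = degree (G [ A ]) v

    Deterministic-forests : Deterministic (forestsDecompositionOrientation rule G)
    Deterministic-forests = Deterministic-ticks (2 * length G + ∣ nonIsolated G ∣)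
      (Deterministic-peel n (nonIsolated G) 0 (λ _ → true))

    -- What the rest of a run guarantees when `A` remains, `μ` is the current and `μ′` the final
    -- orientation. The field `unchanged` connects consecutive rounds: it says that edges with an
    -- endpoint outside `A` are final.
    record Peeled (A : Subset n) (μ μ′ : Orientation n) (t : ℕ) : Set where
      field
        unchanged : ∀ e → ¬ (proj₁ e ∈ₛ A × proj₂ e ∈ₛ A) → μ′ e ≡ μ e
        outdeg≤   : ∀ w → outdeg (G [ A ]) μ′ w ≤ 2 * arboricity G
        time≤     : t ≤ sum (peelCost G A)

    peeled-empty : ∀ {A μ} → Empty A → Peeled A μ μ 0
    peeled-empty {A} {μ} A≡∅ = record
      { unchanged = λ _ _ → refl
      ; outdeg≤   = λ w → ≤-trans (length-filter (λ e → tail μ e Fin.≟ w) (G [ A ]))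
          (≤-trans (≤-reflexive (cong length (filter-none (inside? A)
            (All.universal (λ e in′ → A≡∅ (proj₁ e , proj₁ in′)) G)))) z≤n)
      ; time≤     = z≤n
      }

    peeled-step : ∀ {A v μ μ′ t} d → IsSimple G → v ∈ₛ A →
      (∀ {w} → w ∈ₛ A → degree (G [ A ]) v ≤ degree (G [ A ]) w) →
      Peeled (A ∖ v) (orientFrom v A μ) μ′ t →
      Peeled A μ μ′ ((suc (degree (G [ A ]) v) ∸ d) + (degree G v + t))
    peeled-step {A} {v} {μ} {μ′} {t} d simple v∈A minimal rest = record
      { unchanged = λ e ¬ab → trans
          (unchanged e (λ (a∈ , b∈) → ¬ab (p─q⊆p A ⁅ v ⁆ a∈ , p─q⊆p A ⁅ v ⁆ b∈)))
          (orientFrom-outside μ e v∈A ¬ab)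
      ; outdeg≤ = out
      ; time≤ = begin
          (suc d′ ∸ d) + (degree G v + t)
            -- The saving from starting the search at bucket `d` is given away: 1 + `d′` steps
            -- already fit into the potential of `v`.
            ≤⟨ +-mono-≤ (≤-trans (m∸n≤m (suc d′) d) (s≤s d′≤)) (+-monoʳ-≤ (degree G v) time≤) ⟩
          suc (degree G v) + (degree G v + sum (peelCost G (A ∖ v)))
            ≡⟨ regroup (degree G v) _ ⟩
          (1 + 2 * degree G v) + sum (peelCost G (A ∖ v))
            ≤⟨ ∑peelCost-∖ G v∈A ⟩
          sum (peelCost G A)
            ∎
      }
      where
      open Peeled rest
      open ≤-Reasoning
      d′ = degree (G [ A ]) v

      regroup : ∀ a b → suc a + (a + b) ≡ (1 + 2 * a) + b
      regroup = solve-∀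

      G[A]< : All (uncurry Fin._<_) (G [ A ])
      G[A]< = proj₁ (IsSimple-[] G A simple)

      d′≤ : d′ ≤ degree G v
      d′≤ = subst (λ H → d′ ≤ degree H v) (filter-all (λ _ → yes refl) (All.universal (λ _ → refl) G))
        (filter-filter-mono (incident? v) (incident? v) (inside? A) (λ _ → yes (refl {x = v})) G
          (λ _ _ inc → inc , refl))

      out : ∀ w → outdeg (G [ A ]) μ′ w ≤ 2 * arboricity G
      out w with w Fin.≟ v
      -- The removed vertex has outdegree at most its degree in `G [ A ]`, which is minimal.
      ... | yes refl = begin
        outdeg (G [ A ]) μ′ w                           ≤⟨ m≤m+n _ _ ⟩
        outdeg (G [ A ]) μ′ w + indeg (G [ A ]) μ′ w    ≡⟨ degree≡outdeg+indeg (G [ A ]) μ′ w G[A]< ⟨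
        degree (G [ A ]) w                              ≤⟨ minDegree≤2arboricity G A v simple v∈A minimal ⟩
        2 * arboricity G                                ∎
      -- Edges of `G [ A ]` at `v` are finally directed away from `v`, so an edge leaving another
      -- vertex avoids `v` and is counted by the rest of the run.
      ... | no w≢v = ≤-trans
        (filter-filter-mono (λ e → tail μ′ e Fin.≟ w) (λ e → tail μ′ e Fin.≟ w) (inside? A) (inside? (A ∖ v)) G
          (λ {e} _ in′ t≡w → t≡w , survives e in′ t≡w))
        (outdeg≤ w)
        where
        survives : ∀ e → proj₁ e ∈ₛ A × proj₂ e ∈ₛ A → tail μ′ e ≡ w →
                   proj₁ e ∈ₛ A ∖ v × proj₂ e ∈ₛ A ∖ v
        survives e (a∈ , b∈) t≡w with incident? v e
        ... | no ¬inc = x∈p∧x≢y⇒x∈p-y a∈ (¬inc ∘ inj₁ ∘ sym) , x∈p∧x≢y⇒x∈p-y b∈ (¬inc ∘ inj₂ ∘ sym)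
        ... | yes inc = contradiction (trans (sym t≡w) (trans
          (tail-cong {μ = μ′} {ν = orientFrom v A μ} e (unchanged e (gone inc)))
          (orientFrom-tail μ e inc (a∈ , b∈)))) w≢v
          where
          gone : Incident v e → ¬ (proj₁ e ∈ₛ A ∖ v × proj₂ e ∈ₛ A ∖ v)
          gone (inj₁ refl) (v∈ , _) = v∉A∖v A v v∈
          gone (inj₂ refl) (_ , v∈) = v∉A∖v A v v∈

    -- Each round removes a vertex, so `∣ A ∣ ≤ rounds` guarantees that the rounds cannot run out
    -- while vertices remain.
    peel-outcome : IsSimple G → ∀ rounds A d μ {μ′ t} → ∣ A ∣ ≤ rounds →
                   peel rule G rounds A d μ ⇓ μ′ # t → Peeled A μ μ′ t
    peel-outcome simple zero A d μ A≤0 return =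
      peeled-empty λ (v , v∈A) → contradiction (≤-trans (∣S∣≥1 v∈A) A≤0) λ ()
    peel-outcome simple (suc rounds) A d μ A≤ r with nonempty? A
    peel-outcome simple (suc rounds) A d μ A≤ return | no A≡∅ = peeled-empty A≡∅
    peel-outcome simple (suc rounds) A d μ A≤ r | yes A≢∅
      with rule G A A≢∅
    ... | v , v∈A , minimal with ⇓-ticks⁻ (suc (degree (G [ A ]) v) ∸ (d ∸ 1)) r
    ... | _ , r₁ , refl with ⇓-ticks⁻ (degree G v) r₁
    ... | _ , r₂ , refl = peeled-step (d ∸ 1) simple v∈A minimal
      (peel-outcome simple rounds (A ∖ v) _ _ (≤-pred (≤-trans (x∈p⇒∣p-x∣<∣p∣ v∈A) A≤)) r₂)

    forests-outcome : IsSimple G → ∀ {μ t} → forestsDecompositionOrientation rule G ⇓ μ # t →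
                      (∀ w → outdeg G μ w ≤ 2 * arboricity G) × (t ≤ 10 * length G)
    forests-outcome simple {μ} r with ⇓-ticks⁻ (2 * length G + ∣ nonIsolated G ∣) r
    ... | t , r′ , refl =
      (λ w → subst (λ H → outdeg H μ w ≤ 2 * arboricity G) ([nonIsolated] G) (outdeg≤ w)) ,
      (begin
        (2 * m + ∣ nonIsolated G ∣) + t   ≤⟨ +-mono-≤ (+-monoʳ-≤ (2 * m) (∣nonIsolated∣≤ G simple))
                                                      (≤-trans time≤ (∑peelCost≤ G simple)) ⟩
        (2 * m + 2 * m) + 6 * m           ≡⟨ ten m ⟩
        10 * m                            ∎)
      where
      open ≤-Reasoning
      open Peeled (peel-outcome simple n (nonIsolated G) 0 _ (∣p∣≤n (nonIsolated G)) r′)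
      m = length G
      ten : ∀ m → (2 * m + 2 * m) + 6 * m ≡ 10 * m
      ten = solve-∀

  -- Correctness and palette size of the recursive colouring.

  module _ (split : SplitSubroutine) (linear : IsLinearTimeSplitting split) where

    Deterministic-colouring : ∀ (base : BaseSubroutine) →
      (∀ {n} (G : Graph n) → IsSimple G → Deterministic (base G)) →
      ∀ (G : Graph n) μ h → IsSimple G → Deterministic (orientedEdgeColoring split base G μ h)
    Deterministic-colouring base det G μ zero    simple =
      Deterministic-ticks (1 + length G) (Deterministic->>= (det G simple) (λ _ → return))
    Deterministic-colouring base det G μ (suc h) simple =
      Deterministic->>= (proj₁ (proj₂ linear G μ simple)) λ { {E₁ , E₂} r →
        let open Splitting G E₁ E₂ μ simple (proj₁ (proj₂ (proj₂ linear G μ simple) r)) in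
        Deterministic->>= (Deterministic-colouring base det _ μ h simple₁) λ _ →
        Deterministic->>= (Deterministic-colouring base det _ μ h simple₂) λ _ →
        Deterministic-ticks (1 + length G) return }

    -- The bound is on p + 2 because that quantity survives the induction: two copies give 4, and
    -- the inequality Δ₁ + Δ₂ ≤ Δ + 2 consumes 2 of them.
    colouring-outcome : ∀ (base : BaseSubroutine) →
      (∀ {n} (G : Graph n) → IsSimple G → ∀ {φ t} → base G ⇓ φ # t →
         ProperEdgeColoring G (maxDegree G + 1) φ) →
      ∀ (G : Graph n) μ h → IsSimple G → ∀ {p φ t} → orientedEdgeColoring split base G μ h ⇓ (p , φ) # t →
      ProperEdgeColoring G p φ × (p + 2 ≤ maxDegree G + 3 * 2 ^ h)
    colouring-outcome base proper G μ zero simple r with ⇓-ticks⁻ (1 + length G) r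
    ... | _ , r₁ , _ with ⇓->>=⁻ (base G) r₁
    ... | φ , _ , _ , r₂ , return , _ = proper G simple r₂ , ≤-reflexive (+-assoc (maxDegree G) 1 2)
    colouring-outcome base proper G μ (suc h) simple r with ⇓->>=⁻ (split G μ) r
    ... | (E₁ , E₂) , _ , _ , r₀ , r′ , _ with ⇓->>=⁻ (orientedEdgeColoring split base E₁ μ h) r′
    ... | (p₁ , φ₁) , _ , _ , r₁ , r″ , _ with ⇓->>=⁻ (orientedEdgeColoring split base E₂ μ h) r″
    ... | (p₂ , φ₂) , _ , _ , r₂ , r‴ , _ with ⇓-ticks⁻ (1 + length G) r‴
    ... | _ , return , _ = proper-split (proj₁ ih₁) (proj₁ ih₂) , +-cancelʳ-≤ 2 _ _ (begin
      (p₁ + p₂ + 2) + 2                                               ≡⟨ regroup p₁ p₂ ⟩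
      (p₁ + 2) + (p₂ + 2)                                             ≤⟨ +-mono-≤ (proj₂ ih₁) (proj₂ ih₂) ⟩
      (maxDegree E₁ + 3 * 2 ^ h) + (maxDegree E₂ + 3 * 2 ^ h)         ≡⟨ collect (maxDegree E₁) (maxDegree E₂) (2 ^ h) ⟩
      (maxDegree E₁ + maxDegree E₂) + 3 * (2 * 2 ^ h)                 ≤⟨ +-monoˡ-≤ _ maxDegree-split ⟩
      (maxDegree G + 2) + 3 * (2 * 2 ^ h)                             ≡⟨ shift (maxDegree G) _ ⟩
      (maxDegree G + 3 * (2 * 2 ^ h)) + 2                             ∎)
      where
      open ≤-Reasoning
      open Splitting G E₁ E₂ μ simple (proj₁ (proj₂ (proj₂ linear G μ simple) r₀))
      ih₁ = colouring-outcome base proper E₁ μ h simple₁ r₁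
      ih₂ = colouring-outcome base proper E₂ μ h simple₂ r₂
      regroup : ∀ a b → (a + b + 2) + 2 ≡ (a + 2) + (b + 2)
      regroup = solve-∀
      collect : ∀ a b c → (a + 3 * c) + (b + 3 * c) ≡ (a + b) + 3 * (2 * c)
      collect = solve-∀
      shift : ∀ a b → (a + 2) + b ≡ (a + b) + 2
      shift = solve-∀

-- Arithmetic in ordered fields.

module OrderedFieldProperties (F : OrderedField) where
  open OrderedField F public
  open CommutativeRing commutativeRing public
    using (refl; sym; trans; reflexive; +-cong; +-congˡ; +-congʳ; *-congˡ; *-congʳ;
           +-assoc; +-comm; +-identityˡ; +-identityʳ; -‿inverseˡ; -‿inverseʳ; -‿cong;
           *-assoc; *-comm; *-identityˡ; *-identityʳ; zeroˡ; zeroʳ; distribˡ; distribʳ; ring)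
  open IsTotalOrder isTotalOrder public
    using (total; antisym; isPartialOrder; ≤-respˡ-≈; ≤-respʳ-≈)
    renaming (refl to ≤-refl; reflexive to ≤-reflexive; trans to ≤-trans)
  private
    module R = CommutativeRing commutativeRing
    module Mult = SemiringMult R.semiring
    module RP = RingProperties ring
  open Exp R.commutativeSemiring using (^-distrib-*)

  poset : Poset _ _ _
  poset = record { isPartialOrder = isPartialOrder }

  open PartialOrderReasoning poset

  +-monoʳ-≤ : ∀ z {x y} → x ≤ y → z + x ≤ z + y
  +-monoʳ-≤ z {x} {y} x≤y = begin
    z + x ≈⟨ +-comm z x ⟩
    x + z ≤⟨ +-monoˡ-≤ z x≤y ⟩
    y + z ≈⟨ +-comm y z ⟩
    z + y ∎

  +-mono-≤ : ∀ {x y u v} → x ≤ y → u ≤ v → x + u ≤ y + v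
  +-mono-≤ {x} {y} {u} {v} x≤y u≤v = ≤-trans (+-monoˡ-≤ u x≤y) (+-monoʳ-≤ y u≤v)

  *-monoʳ-≤ : ∀ {z x y} → 0# ≤ z → x ≤ y → z * x ≤ z * y
  *-monoʳ-≤ {z} {x} {y} 0≤z x≤y = begin
    z * x                        ≈⟨ +-identityˡ _ ⟨
    0# + z * x                   ≤⟨ +-monoˡ-≤ (z * x) (*-nonNeg 0≤z 0≤y-x) ⟩
    z * (y + - x) + z * x        ≈⟨ distribˡ z _ x ⟨
    z * ((y + - x) + x)          ≈⟨ *-congˡ (trans (+-assoc y (- x) x) (trans (+-congˡ (-‿inverseˡ x)) (+-identityʳ y))) ⟩
    z * y                        ∎
    where
    0≤y-x : 0# ≤ y + - x
    0≤y-x = ≤-respˡ-≈ (-‿inverseʳ x) (+-monoˡ-≤ (- x) x≤y)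

  *-monoˡ-≤ : ∀ {z x y} → 0# ≤ z → x ≤ y → x * z ≤ y * z
  *-monoˡ-≤ {z} {x} {y} 0≤z x≤y = begin
    x * z ≈⟨ *-comm x z ⟩
    z * x ≤⟨ *-monoʳ-≤ 0≤z x≤y ⟩
    z * y ≈⟨ *-comm z y ⟩
    y * z ∎

  x≤0⇒0≤-x : ∀ {x} → x ≤ 0# → 0# ≤ - x
  x≤0⇒0≤-x {x} x≤0 = begin
    0#        ≈⟨ -‿inverseʳ x ⟨
    x + - x   ≤⟨ +-monoˡ-≤ (- x) x≤0 ⟩
    0# + - x  ≈⟨ +-identityˡ _ ⟩
    - x       ∎

  0≤-x⇒x≤0 : ∀ {x} → 0# ≤ - x → x ≤ 0#
  0≤-x⇒x≤0 {x} 0≤-x = begin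
    x         ≈⟨ +-identityʳ x ⟨
    x + 0#    ≤⟨ +-monoʳ-≤ x 0≤-x ⟩
    x + - x   ≈⟨ -‿inverseʳ x ⟩
    0#        ∎

  0≤1 : 0# ≤ 1#
  0≤1 with total 0# 1#
  ... | inj₁ 0≤1 = 0≤1
  ... | inj₂ 1≤0 = begin
    0#             ≤⟨ *-nonNeg (x≤0⇒0≤-x 1≤0) (x≤0⇒0≤-x 1≤0) ⟩
    - 1# * - 1#    ≈⟨ RP.-1*x≈-x (- 1#) ⟩
    - - 1#         ≈⟨ RP.-‿involutive 1# ⟩
    1#             ∎

  1≰0 : ¬ (1# ≤ 0#)
  1≰0 1≤0 = 1≉0 (antisym 1≤0 0≤1)

  *-inverseˡ : ∀ x → ¬ (x ≈ 0#) → x ⁻¹ * x ≈ 1#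
  *-inverseˡ x x≉0 = trans (*-comm _ _) (*-inverseʳ x x≉0)

  -- If the inverse were at most 0, then `x * - (x ⁻¹)`, which is -1, would be a product of
  -- nonnegative elements.
  ⁻¹-nonNeg : ∀ {x} → 0# ≤ x → ¬ (x ≈ 0#) → 0# ≤ x ⁻¹
  ⁻¹-nonNeg {x} 0≤x x≉0 with total 0# (x ⁻¹)
  ... | inj₁ 0≤x⁻¹ = 0≤x⁻¹
  ... | inj₂ x⁻¹≤0 = contradiction (0≤-x⇒x≤0 (begin
    0#            ≤⟨ *-nonNeg 0≤x (x≤0⇒0≤-x x⁻¹≤0) ⟩
    x * - (x ⁻¹)   ≈⟨ RP.-‿distribʳ-* x (x ⁻¹) ⟨
    - (x * x ⁻¹)  ≈⟨ -‿cong (*-inverseʳ x x≉0) ⟩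
    - 1#          ∎)) 1≰0

  *-cancelˡ-≤ : ∀ {z x y} → 0# ≤ z → ¬ (z ≈ 0#) → z * x ≤ z * y → x ≤ y
  *-cancelˡ-≤ {z} {x} {y} 0≤z z≉0 zx≤zy = begin
    x                ≈⟨ undo x ⟩
    z ⁻¹ * (z * x)   ≤⟨ *-monoʳ-≤ (⁻¹-nonNeg 0≤z z≉0) zx≤zy ⟩
    z ⁻¹ * (z * y)   ≈⟨ undo y ⟨
    y                ∎
    where
    undo : ∀ u → u ≈ z ⁻¹ * (z * u)
    undo u = sym (trans (sym (*-assoc _ _ _)) (trans (*-congʳ (*-inverseˡ z z≉0)) (*-identityˡ u)))

  ≤÷ : ∀ {x y z} → 0# ≤ z → ¬ (z ≈ 0#) → x * z ≤ y → x ≤ y ÷ z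
  ≤÷ {x} {y} {z} 0≤z z≉0 xz≤y = begin
    x               ≈⟨ *-identityʳ x ⟨
    x * 1#          ≈⟨ *-congˡ (*-inverseʳ z z≉0) ⟨
    x * (z * z ⁻¹)  ≈⟨ *-assoc x z _ ⟨
    x * z * z ⁻¹    ≤⟨ *-monoˡ-≤ (⁻¹-nonNeg 0≤z z≉0) xz≤y ⟩
    y ÷ z           ∎

  ÷-cancel : ∀ {x z} → ¬ (z ≈ 0#) → x ÷ z * z ≈ x
  ÷-cancel {x} {z} z≉0 = trans (*-assoc x _ z) (trans (*-congˡ (*-inverseˡ z z≉0)) (*-identityʳ x))

  ^-nonNeg : ∀ {x} k → 0# ≤ x → 0# ≤ x ^ k
  ^-nonNeg zero    0≤x = 0≤1
  ^-nonNeg (suc k) 0≤x = *-nonNeg 0≤x (^-nonNeg k 0≤x)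

  ^-mono-≤ : ∀ {x y} k → 0# ≤ x → x ≤ y → x ^ k ≤ y ^ k
  ^-mono-≤ zero    0≤x x≤y = ≤-refl
  ^-mono-≤ (suc k) 0≤x x≤y = ≤-trans (*-monoˡ-≤ (^-nonNeg k 0≤x) x≤y)
    (*-monoʳ-≤ (≤-trans 0≤x x≤y) (^-mono-≤ k 0≤x x≤y))

  1^ : ∀ k → 1# ^ k ≈ 1#
  1^ zero    = refl
  1^ (suc k) = trans (*-identityˡ _) (1^ k)

  fromℕ-+ : ∀ a b → fromℕ (a ℕ.+ b) ≈ fromℕ a + fromℕ b
  fromℕ-+ = Mult.×-homo-+ 1#

  fromℕ-* : ∀ a b → fromℕ (a ℕ.* b) ≈ fromℕ a * fromℕ b
  fromℕ-* = Mult.×1-homo-*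

  fromℕ-^ : ∀ a k → fromℕ (a ℕ.^ k) ≈ fromℕ a ^ k
  fromℕ-^ a zero    = +-identityʳ 1#
  fromℕ-^ a (suc k) = trans (fromℕ-* a (a ℕ.^ k)) (*-congˡ (fromℕ-^ a k))

  fromℕ-nonNeg : ∀ a → 0# ≤ fromℕ a
  fromℕ-nonNeg zero    = ≤-refl
  fromℕ-nonNeg (suc a) = begin
    0#            ≈⟨ +-identityˡ 0# ⟨
    0# + 0#       ≤⟨ +-mono-≤ 0≤1 (fromℕ-nonNeg a) ⟩
    1# + fromℕ a  ∎

  fromℕ-mono-≤ : ∀ {a b} → a ℕ.≤ b → fromℕ a ≤ fromℕ b
  fromℕ-mono-≤ {b = b} z≤n   = fromℕ-nonNeg b
  fromℕ-mono-≤ (s≤s a≤b)     = +-monoʳ-≤ 1# (fromℕ-mono-≤ a≤b)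

  1≤fromℕ : ∀ {a} → 1 ℕ.≤ a → 1# ≤ fromℕ a
  1≤fromℕ 1≤a = ≤-respˡ-≈ (+-identityʳ 1#) (fromℕ-mono-≤ 1≤a)

  1≤⇒≉0 : ∀ {x} → 1# ≤ x → ¬ (x ≈ 0#)
  1≤⇒≉0 1≤x x≈0 = 1≰0 (≤-respʳ-≈ x≈0 1≤x)

  -- If b < a then `fromℕ b + 1` would be at most `fromℕ b`. It brings 2^h ≤ α back from the field
  -- to the naturals.
  fromℕ-cancel-≤ : ∀ {a b} → fromℕ a ≤ fromℕ b → a ℕ.≤ b
  fromℕ-cancel-≤ {a} {b} fa≤fb = ℕ.≮⇒≥ λ b<a → 1≰0 (begin
    1#                             ≈⟨ +-identityʳ 1# ⟨
    1# + 0#                        ≈⟨ +-congˡ (-‿inverseʳ (fromℕ b)) ⟨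
    1# + (fromℕ b + - fromℕ b)     ≈⟨ +-assoc 1# _ _ ⟨
    fromℕ (suc b) + - fromℕ b      ≤⟨ +-monoˡ-≤ _ (≤-trans (fromℕ-mono-≤ b<a) fa≤fb) ⟩
    fromℕ b + - fromℕ b            ≈⟨ -‿inverseʳ (fromℕ b) ⟩
    0#                             ∎)

  2^-[1+k]≤1 : ∀ k → 2^ -[1+ k ] ≤ 1#
  2^-[1+k]≤1 k = *-cancelˡ-≤ (^-nonNeg (suc k) (fromℕ-nonNeg 2)) b≉0 (begin
    b * b ⁻¹   ≈⟨ *-inverseʳ b b≉0 ⟩
    1#         ≤⟨ 1≤b ⟩
    b          ≈⟨ *-identityʳ b ⟨
    b * 1#     ∎)
    where
    b = fromℕ 2 ^ suc k
    1≤b : 1# ≤ b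
    1≤b = ≤-respˡ-≈ (1^ (suc k)) (^-mono-≤ (suc k) 0≤1 (1≤fromℕ {2} (s≤s z≤n)))
    b≉0 : ¬ (b ≈ 0#)
    b≉0 = 1≤⇒≉0 1≤b

  -- Consequences of the choice of depth.

  module Depth {α h : ℕ} {ε : Carrier} (α≢0 : NonZero α)
               (1/α≤ε : 1# ÷ fromℕ α ≤ ε) (ε<1 : ε < 1#)
               (depth : Algorithms.IsDepth F ε α h) where

    private
      1≤α : 1# ≤ fromℕ α
      1≤α = 1≤fromℕ (ℕ.>-nonZero⁻¹ α {{α≢0}})

    -- This is how the lower bound on ε enters: it pays for the additional colour at depth 0, and it
    -- shows that ε is nonzero.
    1≤εα : 1# ≤ ε * fromℕ α
    1≤εα = ≤-respˡ-≈ (÷-cancel (1≤⇒≉0 1≤α)) (*-monoˡ-≤ (fromℕ-nonNeg α) 1/α≤ε)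

    0≤ε : 0# ≤ ε
    0≤ε = ≤-trans (≤-respʳ-≈ (sym (*-identityˡ _)) (⁻¹-nonNeg (fromℕ-nonNeg α) (1≤⇒≉0 1≤α))) 1/α≤ε

    ε≤1 : ε ≤ 1#
    ε≤1 = proj₁ ε<1

    ε≉0 : ¬ (ε ≈ 0#)
    ε≉0 ε≈0 = 1≤⇒≉0 1≤εα (trans (*-congʳ ε≈0) (zeroˡ _))

    ε^≉0 : ∀ e → ¬ (ε ^ e ≈ 0#)
    ε^≉0 zero    = 1≉0
    ε^≉0 (suc e) ε^≈0 = ε^≉0 e (trans (sym (*-identityˡ _)) (trans (*-congʳ (sym (*-inverseˡ ε ε≉0)))
      (trans (*-assoc _ _ _) (trans (*-congˡ ε^≈0) (zeroʳ _)))))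

    private
      3≉0 : ¬ (fromℕ 3 ≈ 0#)
      3≉0 = 1≤⇒≉0 (1≤fromℕ {3} (s≤s z≤n))

      x : Carrier
      x = ε * fromℕ α ÷ fromℕ 3

      scale : ∀ {y} → x ≤ y → ε * fromℕ α ≤ fromℕ 3 * y
      scale {y} x≤y = begin
        ε * fromℕ α     ≈⟨ ÷-cancel 3≉0 ⟨
        x * fromℕ 3     ≤⟨ *-monoˡ-≤ (fromℕ-nonNeg 3) x≤y ⟩
        y * fromℕ 3     ≈⟨ *-comm y _ ⟩
        fromℕ 3 * y     ∎

      six : ∀ a → 3 ℕ.* (2 ℕ.* a) ≡ 6 ℕ.* a
      six = solve-∀

      bounds : Algorithms.IsDepth F ε α h → (ε * fromℕ α ≤ fromℕ (6 ℕ.* 2 ℕ.^ h)) × ((h ≡ 0) ⊎ (fromℕ (3 ℕ.* 2 ℕ.^ h) ≤ ε * fromℕ α))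
      bounds (ℤ.+ k , (2^k≤x , x<2^1+k) , h≡k) with ≡.trans (ℤ.+-injective h≡k) (ℕ.⊔-identityʳ k)
      ... | ≡.refl = (begin
        ε * fromℕ α                          ≤⟨ scale (proj₁ x<2^1+k) ⟩
        fromℕ 3 * (fromℕ 2 ^ suc k)          ≈⟨ *-congˡ (fromℕ-^ 2 (suc k)) ⟨
        fromℕ 3 * fromℕ (2 ℕ.^ suc k)        ≈⟨ fromℕ-* 3 (2 ℕ.^ suc k) ⟨
        fromℕ (3 ℕ.* (2 ℕ.^ suc k))          ≈⟨ reflexive (≡.cong fromℕ (six (2 ℕ.^ k))) ⟩
        fromℕ (6 ℕ.* 2 ℕ.^ k)                ∎) ,
        inj₂ (begin
        fromℕ (3 ℕ.* 2 ℕ.^ k)                ≈⟨ fromℕ-* 3 (2 ℕ.^ k) ⟩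
        fromℕ 3 * fromℕ (2 ℕ.^ k)            ≈⟨ *-congˡ (fromℕ-^ 2 k) ⟩
        fromℕ 3 * fromℕ 2 ^ k                ≤⟨ *-monoʳ-≤ (fromℕ-nonNeg 3) 2^k≤x ⟩
        fromℕ 3 * x                          ≈⟨ *-comm _ x ⟩
        x * fromℕ 3                          ≈⟨ ÷-cancel 3≉0 ⟩
        ε * fromℕ α                          ∎)
      -- A negative logarithm is truncated to depth 0; then εα/3 < 2^(k+1) ≤ 1, so εα ≤ 3 ≤ 6.
      bounds (-[1+ j ] , (_ , x<2^1+k) , h≡k) with ℤ.+-injective h≡k
      ... | ≡.refl = (begin
        ε * fromℕ α       ≤⟨ scale (≤-trans (proj₁ x<2^1+k) (small j)) ⟩
        fromℕ 3 * 1#      ≈⟨ *-identityʳ _ ⟩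
        fromℕ 3           ≤⟨ fromℕ-mono-≤ {3} {6} (s≤s (s≤s (s≤s z≤n))) ⟩
        fromℕ 6           ∎) , inj₁ ≡.refl
        where
        small : ∀ j → 2^ (ℤ.suc -[1+ j ]) ≤ 1#
        small zero    = ≤-refl
        small (suc j) = 2^-[1+k]≤1 j

    εα≤6*2^h : ε * fromℕ α ≤ fromℕ (6 ℕ.* 2 ℕ.^ h)
    εα≤6*2^h = proj₁ (bounds depth)

    2^h≤α : 2 ℕ.^ h ℕ.≤ α
    2^h≤α with proj₂ (bounds depth)
    ... | inj₁ ≡.refl = ℕ.>-nonZero⁻¹ α {{α≢0}}
    ... | inj₂ 3*2^h≤εα = ℕ.≤-trans (ℕ.m≤n*m (2 ℕ.^ h) 3) (fromℕ-cancel-≤ (begin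
      fromℕ (3 ℕ.* 2 ℕ.^ h)   ≤⟨ 3*2^h≤εα ⟩
      ε * fromℕ α             ≤⟨ *-monoˡ-≤ (fromℕ-nonNeg α) ε≤1 ⟩
      1# * fromℕ α            ≈⟨ *-identityˡ _ ⟩
      fromℕ α                 ∎))

    palette≤ : ∀ {Δ p} → p ℕ.+ 2 ℕ.≤ Δ ℕ.+ 3 ℕ.* 2 ℕ.^ h → fromℕ p ≤ fromℕ Δ + ε * fromℕ α
    palette≤ {Δ} {p} p+2≤ with proj₂ (bounds depth)
    -- At depth 0 the inequality 3·2^h ≤ εα may fail; here p ≤ Δ + 1, and the 1 is covered by εα.
    ... | inj₁ ≡.refl = begin
      fromℕ p                 ≤⟨ fromℕ-mono-≤ (ℕ.+-cancelʳ-≤ 2 p (Δ ℕ.+ 1)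
                                   (ℕ.≤-trans p+2≤ (ℕ.≤-reflexive (≡.sym (ℕ.+-assoc Δ 1 2))))) ⟩
      fromℕ (Δ ℕ.+ 1)         ≈⟨ fromℕ-+ Δ 1 ⟩
      fromℕ Δ + (1# + 0#)     ≈⟨ +-congˡ (+-identityʳ 1#) ⟩
      fromℕ Δ + 1#            ≤⟨ +-monoʳ-≤ _ 1≤εα ⟩
      fromℕ Δ + ε * fromℕ α   ∎
    ... | inj₂ 3*2^h≤εα = begin
      fromℕ p                             ≤⟨ fromℕ-mono-≤ (ℕ.≤-trans (ℕ.m≤m+n p 2) p+2≤) ⟩
      fromℕ (Δ ℕ.+ 3 ℕ.* 2 ℕ.^ h)         ≈⟨ fromℕ-+ Δ _ ⟩
      fromℕ Δ + fromℕ (3 ℕ.* 2 ℕ.^ h)     ≤⟨ +-monoʳ-≤ _ 3*2^h≤εα ⟩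
      fromℕ Δ + ε * fromℕ α               ∎

    -- From 2^h ℓ ≤ 2α + 2^h, εα ≤ 6·2^h and ε ≤ 1 we get 2^h (2ℓ) ε ≤ 26·2^h.
    leafArboricity≤ : fromℕ (2 ℕ.* leafOutdegree (2 ℕ.* α) h) * ε ≤ fromℕ 26
    leafArboricity≤ = *-cancelˡ-≤ (fromℕ-nonNeg b) (1≤⇒≉0 (1≤fromℕ (ℕ.m^n>0 2 h))) (begin
      fromℕ b * (fromℕ (2 ℕ.* ℓ) * ε)                   ≈⟨ *-assoc _ _ ε ⟨
      fromℕ b * fromℕ (2 ℕ.* ℓ) * ε                     ≈⟨ *-congʳ (fromℕ-* b _) ⟨
      fromℕ (b ℕ.* (2 ℕ.* ℓ)) * ε                       ≤⟨ *-monoˡ-≤ 0≤ε (fromℕ-mono-≤ leaf) ⟩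
      fromℕ (4 ℕ.* α ℕ.+ 2 ℕ.* b) * ε                   ≈⟨ *-congʳ (fromℕ-+ (4 ℕ.* α) _) ⟩
      (fromℕ (4 ℕ.* α) + fromℕ (2 ℕ.* b)) * ε           ≈⟨ distribʳ ε _ _ ⟩
      fromℕ (4 ℕ.* α) * ε + fromℕ (2 ℕ.* b) * ε         ≤⟨ +-mono-≤ first second ⟩
      fromℕ (4 ℕ.* (6 ℕ.* b)) + fromℕ (2 ℕ.* b)         ≈⟨ fromℕ-+ (4 ℕ.* (6 ℕ.* b)) _ ⟨
      fromℕ (4 ℕ.* (6 ℕ.* b) ℕ.+ 2 ℕ.* b)               ≈⟨ reflexive (≡.cong fromℕ (total26 b)) ⟩
      fromℕ (b ℕ.* 26)                                  ≈⟨ fromℕ-* b 26 ⟩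
      fromℕ b * fromℕ 26                                ∎)
      where
      b = 2 ℕ.^ h
      ℓ = leafOutdegree (2 ℕ.* α) h
      total26 : ∀ b → 4 ℕ.* (6 ℕ.* b) ℕ.+ 2 ℕ.* b ≡ b ℕ.* 26
      total26 = solve-∀
      double : ∀ b ℓ → b ℕ.* (2 ℕ.* ℓ) ≡ 2 ℕ.* (b ℕ.* ℓ)
      double = solve-∀
      collect : ∀ a b → 2 ℕ.* (2 ℕ.* a ℕ.+ b) ≡ 4 ℕ.* a ℕ.+ 2 ℕ.* b
      collect = solve-∀
      leaf : b ℕ.* (2 ℕ.* ℓ) ℕ.≤ 4 ℕ.* α ℕ.+ 2 ℕ.* b
      leaf = ℕ.≤-trans (ℕ.≤-reflexive (double b ℓ)) (ℕ.≤-trans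
        (ℕ.*-monoʳ-≤ 2 (ℕ.<⇒≤ (leafOutdegree≤ (2 ℕ.* α) h)))
        (ℕ.≤-reflexive (collect α b)))
      first : fromℕ (4 ℕ.* α) * ε ≤ fromℕ (4 ℕ.* (6 ℕ.* b))
      first = begin
        fromℕ (4 ℕ.* α) * ε          ≈⟨ *-congʳ (fromℕ-* 4 α) ⟩
        fromℕ 4 * fromℕ α * ε        ≈⟨ trans (*-assoc _ _ ε) (*-congˡ (*-comm _ ε)) ⟩
        fromℕ 4 * (ε * fromℕ α)      ≤⟨ *-monoʳ-≤ (fromℕ-nonNeg 4) εα≤6*2^h ⟩
        fromℕ 4 * fromℕ (6 ℕ.* b)    ≈⟨ fromℕ-* 4 (6 ℕ.* b) ⟨
        fromℕ (4 ℕ.* (6 ℕ.* b))      ∎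
      second : fromℕ (2 ℕ.* b) * ε ≤ fromℕ (2 ℕ.* b)
      second = ≤-respʳ-≈ (*-identityʳ _) (*-monoʳ-≤ (fromℕ-nonNeg (2 ℕ.* b)) ε≤1)

    -- Spends one factor ε on each of the e factors 2ℓ, each product being at most 26.
    leafTerm≤ : ∀ e x → let ℓ = leafOutdegree (2 ℕ.* α) h in
                fromℕ (x ℕ.* (2 ℕ.* ℓ) ℕ.^ e) * ε ^ e ≤ fromℕ (x ℕ.* 26 ℕ.^ e)
    leafTerm≤ e x = begin
      fromℕ (x ℕ.* a ℕ.^ e) * ε ^ e            ≈⟨ *-congʳ (fromℕ-* x (a ℕ.^ e)) ⟩
      fromℕ x * fromℕ (a ℕ.^ e) * ε ^ e        ≈⟨ *-assoc _ _ _ ⟩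
      fromℕ x * (fromℕ (a ℕ.^ e) * ε ^ e)      ≈⟨ *-congˡ (*-congʳ (fromℕ-^ a e)) ⟩
      fromℕ x * (fromℕ a ^ e * ε ^ e)          ≈⟨ *-congˡ (^-distrib-* (fromℕ a) ε e) ⟨
      fromℕ x * (fromℕ a * ε) ^ e              ≤⟨ *-monoʳ-≤ (fromℕ-nonNeg x)
                                                   (^-mono-≤ e (*-nonNeg (fromℕ-nonNeg a) 0≤ε) leafArboricity≤) ⟩
      fromℕ x * fromℕ 26 ^ e                   ≈⟨ *-congˡ (fromℕ-^ 26 e) ⟨
      fromℕ x * fromℕ (26 ℕ.^ e)               ≈⟨ fromℕ-* x _ ⟨
      fromℕ (x ℕ.* 26 ℕ.^ e)                   ∎
      where a = 2 ℕ.* leafOutdegree (2 ℕ.* α) h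

    ε^≤1 : ∀ e → ε ^ e ≤ 1#
    ε^≤1 e = ≤-respʳ-≈ (1^ e) (^-mono-≤ e 0≤ε ε≤1)

-- Expected running time of composed computations.

module Expectation (F : OrderedField) where
  open Algorithms F
  open OrderedFieldProperties F
  open Outcomes F
  open PartialOrderReasoning poset
  private
    E = truncatedExpectedTime

  Σ-mono : ∀ N {f g : ℕ → Carrier} → (∀ i → f i ≤ g i) → (Σ[i< N ] f) ≤ (Σ[i< N ] g)
  Σ-mono zero    f≤g = ≤-refl
  Σ-mono (suc N) f≤g = +-mono-≤ (f≤g 0) (Σ-mono N (λ i → f≤g (suc i)))

  Σ-distrib : ∀ N (f g : ℕ → Carrier) q →
    (Σ[i< N ] (λ i → f i * (g i + q))) ≈ (Σ[i< N ] (λ i → f i * g i)) + (Σ[i< N ] f) * q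
  Σ-distrib zero    f g q = sym (trans (+-congˡ (zeroˡ q)) (+-identityʳ 0#))
  Σ-distrib (suc N) f g q = begin-equality
    f 0 * (g 0 + q) + (Σ[i< N ] (λ i → f (suc i) * (g (suc i) + q)))
      ≈⟨ +-cong (distribˡ (f 0) (g 0) q) (Σ-distrib N (f ∘ suc) (g ∘ suc) q) ⟩
    (f 0 * g 0 + f 0 * q) + ((Σ[i< N ] (λ i → f (suc i) * g (suc i))) + (Σ[i< N ] (f ∘ suc)) * q)
      ≈⟨ interchange _ _ _ _ ⟩
    (f 0 * g 0 + (Σ[i< N ] (λ i → f (suc i) * g (suc i)))) + (f 0 * q + (Σ[i< N ] (f ∘ suc)) * q)
      ≈⟨ +-congˡ (distribʳ q (f 0) _) ⟨
    (f 0 * g 0 + (Σ[i< N ] (λ i → f (suc i) * g (suc i)))) + (f 0 + (Σ[i< N ] (f ∘ suc))) * q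
      ∎
    where open CommutativeSemigroupProperties (CommutativeRing.+-commutativeSemigroup commutativeRing) using (interchange)

  -- Positivity of a weight is undecidable, so q has to bound f on all values.
  E->>=-≤ : ∀ N (c : Comp A) {f : A → Comp B} {q} → 0# ≤ q → (∀ a → E N (f a) ≤ q) →
            E N (c >>= f) ≤ E N c + q
  E->>=-≤ N (return a) {q = q} 0≤q f≤q = ≤-respʳ-≈ (sym (+-identityˡ q)) (f≤q a)
  E->>=-≤ N (tick c)   {q = q} 0≤q f≤q = ≤-respʳ-≈ (sym (+-assoc 1# _ q)) (+-monoʳ-≤ 1# (E->>=-≤ N c 0≤q f≤q))
  E->>=-≤ N (draw d k) {f} {q} 0≤q f≤q = begin
    (Σ[i< N ] (λ i → weight d i * E N (k i >>= f)))
      ≤⟨ Σ-mono N (λ i → *-monoʳ-≤ (nonNeg d i) (E->>=-≤ N (k i) 0≤q f≤q)) ⟩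
    (Σ[i< N ] (λ i → weight d i * (E N (k i) + q)))
      ≈⟨ Σ-distrib N (weight d) (λ i → E N (k i)) q ⟩
    E N (draw d k) + (Σ[i< N ] (weight d)) * q
      ≤⟨ +-monoʳ-≤ _ (≤-respʳ-≈ (*-identityˡ q) (*-monoˡ-≤ 0≤q (total≤1 d N))) ⟩
    E N (draw d k) + q
      ∎

  -- Here the continuation is evaluated only at the actual outcome of `c`, so that what is known
  -- about this outcome (small outdegrees, a balanced splitting) can be used to bound the remaining
  -- time.
  E-Deterministic->>= : ∀ N {c : Comp A} {f : A → Comp B} {a t} → Deterministic c → c ⇓ a # t →
                        E N (c >>= f) ≈ fromℕ t + E N (f a)
  E-Deterministic->>= N return   return   = sym (+-identityˡ _)
  E-Deterministic->>= N (tick d) (tick r) =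
    trans (+-congˡ (E-Deterministic->>= N d r)) (sym (+-assoc 1# _ _))

  E-Deterministic : ∀ N {c : Comp A} {a t} → Deterministic c → c ⇓ a # t → E N c ≈ fromℕ t
  E-Deterministic N return   return   = refl
  E-Deterministic N (tick d) (tick r) = +-congˡ (E-Deterministic N d r)

  E-ticks : ∀ N s {c : Comp A} → E N (ticks s >> c) ≈ fromℕ s + E N c
  E-ticks N zero    = sym (+-identityˡ _)
  E-ticks N (suc s) = trans (+-congˡ (E-ticks N s)) (sym (+-assoc 1# _ _))

  ExpectedTime->>=-≤ : ∀ {c : Comp A} {f : A → Comp B} {s t} →
    ExpectedTime c ≤ fromℕ s → (∀ a → ExpectedTime f a ≤ fromℕ t) →
    ExpectedTime (c >>= f) ≤ fromℕ (s ℕ.+ t)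
  ExpectedTime->>=-≤ {c = c} {s = s} {t} c≤s f≤t N = ≤-trans
    (E->>=-≤ N c (fromℕ-nonNeg t) (λ a → f≤t a N))
    (≤-trans (+-monoˡ-≤ _ (c≤s N)) (≤-reflexive (sym (fromℕ-+ s t))))

  ExpectedTime-Deterministic->>=-≤ : ∀ {c : Comp A} {f : A → Comp B} {a s t} →
    Deterministic c → c ⇓ a # s → ExpectedTime (f a) ≤ fromℕ t →
    ExpectedTime (c >>= f) ≤ fromℕ (s ℕ.+ t)
  ExpectedTime-Deterministic->>=-≤ {s = s} {t} d r f≤t N = ≤-trans
    (≤-reflexive (E-Deterministic->>= N d r))
    (≤-trans (+-monoʳ-≤ _ (f≤t N)) (≤-reflexive (sym (fromℕ-+ s t))))

  ExpectedTime-ticks-≤ : ∀ s {c : Comp A} {t} → ExpectedTime c ≤ fromℕ t →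
                         ExpectedTime (ticks s >> c) ≤ fromℕ (s ℕ.+ t)
  ExpectedTime-ticks-≤ s {t = t} c≤t N = ≤-trans
    (≤-reflexive (E-ticks N s))
    (≤-trans (+-monoʳ-≤ _ (c≤t N)) (≤-reflexive (sym (fromℕ-+ s t))))

  -- Running time of the procedure.

  module Cost (split : SplitSubroutine) (linear : IsLinearTimeSplitting split)
              (base : BaseSubroutine) (c e : ℕ)
              (base≤ : ∀ {n} (G : Graph n) → IsSimple G → ExpectedTime (base G) ≤
                fromℕ (c ℕ.* (1 ℕ.+ length G ℕ.* arboricity G ℕ.^ e ℕ.* ⌈log₂ n ⌉))) where

    -- Bounds the constant part and the coefficient of m in the cost of a single call, apart from
    -- the arboricity term at the leaves.
    K : ℕ
    K = c ℕ.+ proj₁ linear ℕ.+ 1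

    -- A recursion of depth h has fewer than 2·2^h calls, and each of its h + 1 levels distributes
    -- the m edges among its calls. The last summand is the cost of all leaves that depends on their
    -- arboricity, at most twice their outdegree bound.
    colouringBound : (m L d h : ℕ) → ℕ
    colouringBound m L d h =
      K ℕ.* (2 ℕ.* 2 ℕ.^ h ℕ.+ suc h ℕ.* m) ℕ.+ c ℕ.* m ℕ.* L ℕ.* (2 ℕ.* leafOutdegree d h) ℕ.^ e

    -- The summand K is the slack that absorbs the constant cost of each call.
    colouring-time : ∀ {n} (G : Graph n) μ h {d} → IsSimple G → (∀ v → outdeg G μ v ℕ.≤ d) →
      ∃ λ w → (w ℕ.+ K ℕ.≤ colouringBound (length G) ⌈log₂ n ⌉ d h) ×
              (ExpectedTime (orientedEdgeColoring split base G μ h) ≤ fromℕ w)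
    colouring-time {n} G μ zero {d} simple out≤d =
      1 ℕ.+ length G ℕ.+ (b ℕ.+ 0) ,
      leafCost≤ c (proj₁ linear) (length G) ⌈log₂ n ⌉ (ℕ.^-monoˡ-≤ e (arboricity≤2outdeg G μ out≤d)) ,
      ExpectedTime-ticks-≤ (1 ℕ.+ length G) {t = b ℕ.+ 0}
        (ExpectedTime->>=-≤ {c = base G} {s = b} {t = 0} (base≤ G simple) (λ _ _ → ≤-refl))
      where b = c ℕ.* (1 ℕ.+ length G ℕ.* arboricity G ℕ.^ e ℕ.* ⌈log₂ n ⌉)
    colouring-time {n} G μ (suc h) {d} simple out≤d
      with outcome (proj₁ (proj₂ linear G μ simple))
    ... | (E₁ , E₂) , t , r with proj₂ (proj₂ linear G μ simple) r
    ... | splitting , t≤ with Splitting.outdeg-split G E₁ E₂ μ simple splitting out≤d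
    ... | out₁≤ , out₂≤
      with colouring-time E₁ μ h (Splitting.simple₁ G E₁ E₂ μ simple splitting) out₁≤
         | colouring-time E₂ μ h (Splitting.simple₂ G E₁ E₂ μ simple splitting) out₂≤
    ... | w₁ , w₁≤ , E₁≤ | w₂ , w₂≤ , E₂≤ = t ℕ.+ (w₁ ℕ.+ (w₂ ℕ.+ (1 ℕ.+ length G ℕ.+ 0))) ,
      innerCost≤ c (proj₁ linear) ⌈log₂ n ⌉ ((2 ℕ.* leafOutdegree d (suc h)) ℕ.^ e) (2 ℕ.^ h) (suc h) {w₁ = w₁} {w₂}
        (Splitting.length-split G E₁ E₂ μ simple splitting) t≤ w₁≤ w₂≤ ,
      ExpectedTime-Deterministic->>=-≤ (proj₁ (proj₂ linear G μ simple)) r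
        -- The cost after a recursive call does not depend on the colouring it returns, so the
        -- bounds required uniformly in the result are available.
        (ExpectedTime->>=-≤ {c = orientedEdgeColoring split base E₁ μ h} {s = w₁} {t = w₂ ℕ.+ (1 ℕ.+ length G ℕ.+ 0)} E₁≤ λ _ →
         ExpectedTime->>=-≤ {c = orientedEdgeColoring split base E₂ μ h} {s = w₂} {t = 1 ℕ.+ length G ℕ.+ 0} E₂≤ λ _ →
         ExpectedTime-ticks-≤ (1 ℕ.+ length G) {t = 0} (λ _ → ≤-refl))

    arboricityColouring-time : ∀ {n} (rule : MinDegreeRule) (G : Graph n) h → IsSimple G →
      ∃ λ w → (w ℕ.≤ 10 ℕ.* length G ℕ.+ colouringBound (length G) ⌈log₂ n ⌉ (2 ℕ.* arboricity G) h) ×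
              (ExpectedTime (arboricityEdgeColoring rule split base G h) ≤ fromℕ w)
    arboricityColouring-time rule G h simple with outcome (Deterministic-forests rule G)
    ... | μ , t , r with forests-outcome rule G simple r
    ... | out≤ , t≤ with colouring-time G μ h simple out≤
    ... | w , w≤ , E≤ = t ℕ.+ w , ℕ.+-mono-≤ t≤ (ℕ.≤-trans (ℕ.m≤m+n w K) w≤) ,
      ExpectedTime-Deterministic->>=-≤ {t = w} (Deterministic-forests rule G) r E≤

    constant : ℕ
    constant = 10 ℕ.+ 5 ℕ.* K ℕ.+ c ℕ.* 26 ℕ.^ e

    -- `z` is a separate variable because for e = 1 the denominator of the theorem is ε, whereas
    -- `ε ^ 1` unfolds to `ε * 1#`.
    expectedTime≤ : ∀ {n} (rule : MinDegreeRule) (G : Graph n) {h ε z} → IsSimple G →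
      NonZero (arboricity G) → 1# ÷ fromℕ (arboricity G) ≤ ε → ε < 1# → IsDepth ε (arboricity G) h →
      z ≈ ε ^ e →
      ExpectedTime (arboricityEdgeColoring rule split base G h) ≤
        (fromℕ constant * (fromℕ (length G ℕ.* ⌈log₂ n ⌉) ÷ z))
    expectedTime≤ {n} rule G {h} {ε} {z} simple α≢0 1/α≤ε ε<1 depth z≈ε^e N
      with arboricityColouring-time rule G h simple
    ... | w , w≤ , E≤ = begin
      E N (arboricityEdgeColoring rule split base G h)      ≤⟨ E≤ N ⟩
      fromℕ w                                              ≤⟨ ≤÷ 0≤z z≉0 scaled ⟩
      fromℕ constant * fromℕ (m ℕ.* L) ÷ z                 ≈⟨ *-assoc _ _ _ ⟩
      fromℕ constant * (fromℕ (m ℕ.* L) ÷ z)               ∎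
      where
      open Depth α≢0 1/α≤ε ε<1 depth
      m = length G
      L = ⌈log₂ n ⌉
      low  = 10 ℕ.* m ℕ.+ K ℕ.* (2 ℕ.* 2 ℕ.^ h ℕ.+ suc h ℕ.* m)
      high = c ℕ.* m ℕ.* L

      0≤ε^e : 0# ≤ ε ^ e
      0≤ε^e = ^-nonNeg e 0≤ε

      0≤z : 0# ≤ z
      0≤z = ≤-respʳ-≈ (sym z≈ε^e) 0≤ε^e

      z≉0 : ¬ (z ≈ 0#)
      z≉0 z≈0 = ε^≉0 e (trans (sym z≈ε^e) z≈0)

      2^h≤m : 2 ℕ.^ h ℕ.≤ m
      2^h≤m = ℕ.≤-trans 2^h≤α (arboricity≤length G)

      low≤ : low ℕ.≤ (10 ℕ.+ 5 ℕ.* K) ℕ.* (m ℕ.* L)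
      -- From m ≥ 2^h ≥ 1 there is an edge, hence at least two vertices and L ≥ 1.
      low≤ = lowOrderCost≤ K m L (2 ℕ.^ h) h 2^h≤m (depth≤2⌈log₂n⌉ G simple 2^h≤m)
        (1≤⌈log₂n⌉ G simple (ℕ.≤-trans (ℕ.m^n>0 2 h) 2^h≤m))

      collect : ∀ K c x m L → (10 ℕ.+ 5 ℕ.* K) ℕ.* (m ℕ.* L) ℕ.+ c ℕ.* m ℕ.* L ℕ.* x ≡
                              (10 ℕ.+ 5 ℕ.* K ℕ.+ c ℕ.* x) ℕ.* (m ℕ.* L)
      collect = solve-∀

      X = (2 ℕ.* leafOutdegree (2 ℕ.* arboricity G) h) ℕ.^ e

      scaled : fromℕ w * z ≤ fromℕ constant * fromℕ (m ℕ.* L)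
      scaled = begin
        fromℕ w * z                                           ≈⟨ *-congˡ z≈ε^e ⟩
        fromℕ w * ε ^ e                                       ≤⟨ *-monoˡ-≤ 0≤ε^e (fromℕ-mono-≤
                                                                  (ℕ.≤-trans w≤ (ℕ.≤-reflexive (≡.sym (ℕ.+-assoc (10 ℕ.* m) _ _))))) ⟩
        fromℕ (low ℕ.+ high ℕ.* X) * ε ^ e                    ≈⟨ *-congʳ (fromℕ-+ low (high ℕ.* X)) ⟩
        (fromℕ low + fromℕ (high ℕ.* X)) * ε ^ e              ≈⟨ distribʳ (ε ^ e) _ _ ⟩
        -- Only the leaf term needs the factor ε^e; in the low-order term it is bounded by 1.
        fromℕ low * ε ^ e + fromℕ (high ℕ.* X) * ε ^ e        ≤⟨ +-mono-≤ (*-monoʳ-≤ (fromℕ-nonNeg low) (ε^≤1 e)) (leafTerm≤ e high) ⟩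
        fromℕ low * 1# + fromℕ (high ℕ.* 26 ℕ.^ e)            ≈⟨ +-congʳ (*-identityʳ _) ⟩
        fromℕ low + fromℕ (high ℕ.* 26 ℕ.^ e)                 ≈⟨ fromℕ-+ low (high ℕ.* 26 ℕ.^ e) ⟨
        fromℕ (low ℕ.+ high ℕ.* 26 ℕ.^ e)                     ≤⟨ fromℕ-mono-≤ (ℕ.≤-trans (ℕ.+-monoˡ-≤ (high ℕ.* 26 ℕ.^ e) low≤)
                                                                  (ℕ.≤-reflexive (collect K c (26 ℕ.^ e) m L))) ⟩
        fromℕ (constant ℕ.* (m ℕ.* L))                        ≈⟨ fromℕ-* constant (m ℕ.* L) ⟩
        fromℕ constant * fromℕ (m ℕ.* L)                      ∎

-- Combining colours and time.

module _ (F : OrderedField) where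
  open OrderedField F using (1#; _÷_; _<_; _≤_; fromℕ; _+_; _*_)
  open Algorithms F
  open Outcomes F

  arboricityColouring-outcome :
    (split : SplitSubroutine) (base : BaseSubroutine) → IsLinearTimeSplitting split →
    (∀ {n} (G : Graph n) → IsSimple G → ∀ {φ t} → base G ⇓ φ # t →
       ProperEdgeColoring G (maxDegree G ℕ.+ 1) φ) →
    ∀ {n} (rule : MinDegreeRule) (G : Graph n) {h ε} → IsSimple G →
    NonZero (arboricity G) → 1# ÷ fromℕ (arboricity G) ≤ ε → ε < 1# → IsDepth ε (arboricity G) h →
    ∀ {k φ t} → arboricityEdgeColoring rule split base G h ⇓ (k , φ) # t →
    ProperEdgeColoring G k φ × (fromℕ k ≤ fromℕ (maxDegree G) + ε * fromℕ (arboricity G))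
  arboricityColouring-outcome split base linear proper rule G {h} simple α≢0 1/α≤ε ε<1 depth r
    with ⇓->>=⁻ (forestsDecompositionOrientation rule G) r
  ... | μ , _ , _ , _ , r′ , _ with colouring-outcome split linear base proper G μ h simple r′
  ... | colouring , palette = colouring , palette≤ {maxDegree G} palette
    where open OrderedFieldProperties.Depth F α≢0 1/α≤ε ε<1 depth

theorem4p16 :
    (F : OrderedField) →
    let open OrderedField F
        open Algorithms F in
    (split : SplitSubroutine) → IsLinearTimeSplitting split →
    ( (base : BaseSubroutine) → IsDeterministicBase base →
      ∃ λ (C : ℕ) →
        ∀ {n} (G : Graph n) → IsSimple G →
        let m = length G
            Δ = maxDegree G
            α = arboricity G in
        NonZero α →
        ∀ ε → 1# ÷ fromℕ α ≤ ε → ε < 1# →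
        ∀ h → IsDepth ε α h →
        ∀ (rule : MinDegreeRule) →
        Deterministic (arboricityEdgeColoring rule split base G h) ×
        (∀ {k φ t} → arboricityEdgeColoring rule split base G h ⇓ (k , φ) # t →
           ProperEdgeColoring G k φ ×
           (fromℕ k ≤ fromℕ Δ + ε * fromℕ α) ×
           (fromℕ t ≤ fromℕ C * (fromℕ (m ℕ.* ⌈log₂ n ⌉) ÷ (ε ^ 7)))) )
    ×
    ( (base : BaseSubroutine) → IsRandomizedBase base →
      ∃ λ (C : ℕ) →
        ∀ {n} (G : Graph n) → IsSimple G →
        let m = length G
            Δ = maxDegree G
            α = arboricity G in
        NonZero α →
        ∀ ε → 1# ÷ fromℕ α ≤ ε → ε < 1# →
        ∀ h → IsDepth ε α h →
        ∀ (rule : MinDegreeRule) →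
        (∀ {k φ t} → arboricityEdgeColoring rule split base G h ⇓ (k , φ) # t →
           ProperEdgeColoring G k φ ×
           (fromℕ k ≤ fromℕ Δ + ε * fromℕ α)) ×
        (ExpectedTime (arboricityEdgeColoring rule split base G h) ≤
           (fromℕ C * (fromℕ (m ℕ.* ⌈log₂ n ⌉) ÷ ε))) )
theorem4p16 F split linear =
  (λ base det → Cost.constant split linear base (proj₁ det) 7 (deterministic-time≤ base det) ,
    λ G simple α≢0 ε 1/α≤ε ε<1 h depth rule →
      let halts = Deterministic->>= (Deterministic-forests rule G) λ {μ} _ →
                    Deterministic-colouring split linear base
                      (λ H simple → proj₁ (proj₂ det H simple)) G μ h simple
      in halts , λ r →
        let proper , palette = arboricityColouring-outcome F split base linear
              (λ H simple r → proj₁ (proj₂ (proj₂ det H simple) r)) rule G simple α≢0 1/α≤ε ε<1 depth r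
        -- A deterministic computation makes no draws, so its truncated expected time is its number
        -- of steps for every truncation, in particular for N = 0.
        in proper , palette , ≤-respˡ-≈ (E-Deterministic 0 halts r)
             (Cost.expectedTime≤ split linear base (proj₁ det) 7 (deterministic-time≤ base det)
               rule G simple α≢0 1/α≤ε ε<1 depth refl 0)) ,
  (λ base rand → Cost.constant split linear base (proj₁ rand) 1 (randomized-time≤ base rand) ,
    λ G simple α≢0 ε 1/α≤ε ε<1 h depth rule →
      (λ r → arboricityColouring-outcome F split base linear (λ H simple → proj₁ (proj₂ rand H simple))
               rule G simple α≢0 1/α≤ε ε<1 depth r) ,
      Cost.expectedTime≤ split linear base (proj₁ rand) 1 (randomized-time≤ base rand)
        rule G simple α≢0 1/α≤ε ε<1 depth (sym (*-identityʳ ε)))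
  where
  open OrderedFieldProperties F
  open Algorithms F
  open Outcomes F
  open Expectation F

  deterministic-time≤ : (base : BaseSubroutine) (det : IsDeterministicBase base) →
    ∀ {n} (G : Graph n) → IsSimple G → ExpectedTime (base G) ≤
      fromℕ (proj₁ det ℕ.* (1 ℕ.+ length G ℕ.* arboricity G ℕ.^ 7 ℕ.* ⌈log₂ n ⌉))
  deterministic-time≤ base det G simple N with proj₂ det G simple
  ... | halts , spec with outcome halts
  ... | _ , _ , r = ≤-trans (≤-reflexive (E-Deterministic N halts r)) (fromℕ-mono-≤ (proj₂ (spec r)))

  randomized-time≤ : (base : BaseSubroutine) (rand : IsRandomizedBase base) →
    ∀ {n} (G : Graph n) → IsSimple G → ExpectedTime (base G) ≤
      fromℕ (proj₁ rand ℕ.* (1 ℕ.+ length G ℕ.* arboricity G ℕ.^ 1 ℕ.* ⌈log₂ n ⌉))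
  randomized-time≤ base rand {n} G simple = ≡.subst
    (λ a → ExpectedTime (base G) ≤ fromℕ (proj₁ rand ℕ.* (1 ℕ.+ length G ℕ.* a ℕ.* ⌈log₂ n ⌉)))
    (≡.sym (ℕ.*-identityʳ (arboricity G))) (proj₂ (proj₂ rand G simple))
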